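{- For every integer $d\ge 1$, the following identities hold: (1) $P_d = \sum_{\delta \in \mathrm{PCom}_{\mathrm{sqf}}(d)} (-1)^{\ell(\delta)-1} L(\delta)\, H_\delta$; (2) $P_d = \sum_{\delta \in \mathrm{PCom}_{\mathrm{sqf}}(d)} (-1)^{\ell(\delta)} L(\delta)\, E_\delta$.
   Context: A composition of $n\ge 0$ is a finite tuple $\alpha=(\alpha_1,\dots,\alpha_k)$ of positive integers with sum $|\alpha|=n$; $\ell(\alpha)=k$; the empty composition is the only composition of $0$. A polycomposition of $n$ is a sequence $\delta=(\alpha^{(1)},\alpha^{(2)},\dots)$ of (possibly empty) compositions with $\sum_{i\ge1} i|\alpha^{(i)}|=n$; write $\delta|^i=\alpha^{(i)}$ and, formally (not exponentiation), $\delta=(\alpha^{(1)})^1(\alpha^{(2)})^2\cdots$, omitting empty compositions. Its length is $\ell(\delta)=\sum_i \ell(\delta|^i)$. Each part $d$ of $\delta|^r$ gives a block $d^r$ of $\delta$ (degree $d$, multiplicity $r$). For nonempty $\delta$ with largest multiplicity $r$ and $\alpha=\delta|^r$, set $L(\delta)=r\,\alpha_{\ell(\alpha)}$ (the size of the last block). $\mathrm{PCom}_{\mathrm{sqf}}(d)$ is the set of square-free polycompositions of $d$: those of the form $(\alpha)^1$ with $\alpha$ a composition of $d$. For such $\delta$, $L(\delta)$ is the last part of $\alpha$. Let $x_{i,j}$ ($i,j\ge 1$) be indeterminates with $\deg x_{i,j}=i$; all series have rational coefficients. A monomial is square-free if every exponent is at most $1$. $H_d$ is the sum of all monomials of degree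 $d$; $E_d$ is the sum over square-free monomials $f$ of degree $d$ of $(-1)^{m(f)}f$, where $m(f)$ is the number of indeterminates in $f$; for $d\ge1$, $P_d=\sum_{k\mid d}\sum_{j\ge1} k\,x_{k,j}^{d/k}$, with $k$ ranging over positive divisors of $d$. For $F\in\{H,E\}$ and a block $d^r$, $F_{d^r}$ is obtained from $F_d$ by replacing each $x_{i,j}$ by $x_{i,j}^r$, and for a polycomposition $\delta$, $F_\delta=\prod F_{d^r}$ over all blocks $d^r$ of $\delta$ (counted with repetition). -}

module Defs where

open import Data.Bool.Base using (if_then_else_)
open import Data.Integer.Base as ℤ using (ℤ; -1ℤ)
open import Data.List.Base
  using (List; []; _∷_; [_]; _++_; map; concat; foldr; filter; length; replicate; upTo; last;
         cartesianProductWith)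
open import Data.List.Membership.Propositional using (_∈_)
open import Data.List.Membership.Propositional.Properties
  using (∈-map⁺; ∈-map⁻; ∈-++⁺ˡ; ∈-++⁺ʳ; ∈-++⁻)
open import Data.List.Properties using (∷-injectiveˡ; ∷-injectiveʳ)
open import Data.List.Relation.Unary.All using (All; []; _∷_; all?)
open import Data.List.Relation.Unary.AllPairs using ([]; _∷_)
open import Data.List.Relation.Unary.Any using (here)
open import Data.List.Relation.Unary.Unique.Propositional using (Unique)
import Data.List.Relation.Unary.Unique.Propositional.Properties as Unique
open import Data.Maybe.Base using (maybe′)
open import Data.Nat.Base
  using (ℕ; zero; suc; _+_; _*_; _∸_; _⊔_; _/_; _≤_; NonZero; >-nonZero; >-nonZero⁻¹)
open import Data.Nat.Divisibility using (_∣?_)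
open import Data.Nat.ListAction using (sum)
open import Data.Nat.Properties
  using (_≟_; _≤?_; _<?_; ≤-refl; <⇒≤; n≮n; <-≤-trans; m≤n⇒m<n∨m≡n; m≤m+n; +-suc; +-identityʳ;
         +-cancelˡ-≡)
open import Data.Product.Base using (_×_; _,_; ∃-syntax; zip′)
open import Data.Rational.Base as ℚ using (ℚ; 0ℚ; 1ℚ)
open import Data.Sum.Base using (inj₁; inj₂)
open import Function.Base using (_∘_)
open import Function.Bundles using (_⇔_; mk⇔; Equivalence)
open import Level using (0ℓ)
open import Relation.Binary.Core using (Rel)
open import Relation.Binary.Definitions using (Decidable)
open import Relation.Binary.PropositionalEquality using (_≡_; refl; sym; trans; cong; subst)
open import Relation.Nullary.Decidable using (Dec; does; map′; _×-dec_)
open import Relation.Nullary.Negation using (¬_; contradiction)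
open import Relation.Unary using () renaming (Decidable to Decidable₁)

------------------------------------------------------------------------
-- Compositions and polycompositions

Composition : Set
Composition = List ℕ

IsComposition : ℕ → Composition → Set
IsComposition n α = All NonZero α × sum α ≡ n

-- The entry at position i (counting from 0) is δ|^(i+1); later terms of the
-- sequence are empty.
Polycomposition : Set
Polycomposition = List Composition

ℓ : Polycomposition → ℕ
ℓ δ = sum (map length δ)

record Block : Set where
  constructor block
  field
    degree       : ℕ
    multiplicity : ℕ
    ⦃ multiplicity≢0 ⦄ : NonZero multiplicity

  size : ℕ
  size = multiplicity * degree

blocksFrom : (r : ℕ) ⦃ _ : NonZero r ⦄ → Polycomposition → List Block
blocksFrom r []      = []
blocksFrom r (α ∷ δ) = map (λ d → block d r) α ++ blocksFrom (suc r) δ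

-- In increasing order of multiplicity, so that the last block is the last part
-- of δ|^r for the largest r with δ|^r nonempty.
blocks : Polycomposition → List Block
blocks = blocksFrom 1

-- The value for the empty polycomposition is a dummy.
L : Polycomposition → ℕ
L δ = maybe′ Block.size 0 (last (blocks δ))

IsSquareFreePolycomposition : ℕ → Polycomposition → Set
IsSquareFreePolycomposition d δ = ∃[ α ] IsComposition d α × δ ≡ [ α ]

-- The compositions of a + n with first part at least a (for a ≥ 1): the first
-- part is either a, followed by a composition of n, or at least a + 1.
compositionsFrom : ℕ → ℕ → List Composition
compositionsFrom a zero    = [ [ a ] ]
compositionsFrom a (suc n) =
  map (a ∷_) (compositionsFrom 1 n) ++ compositionsFrom (suc a) n

compositions : ℕ → List Composition
compositions zero    = [ [] ]
compositions (suc n) = compositionsFrom 1 n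

PComSqf : ℕ → List Polycomposition
PComSqf d = map [_] (compositions d)

private
  FirstAtLeast : ℕ → ℕ → Composition → Set
  FirstAtLeast a s α = ∃[ b ] ∃[ β ] α ≡ b ∷ β × a ≤ b × All NonZero β × b + sum β ≡ s

  from-sound : ∀ a n {α} → α ∈ compositionsFrom a n → FirstAtLeast a (a + n) α
  from-sound a zero    (here refl) = a , [] , refl , ≤-refl , [] , refl
  from-sound a (suc n) α∈ with ∈-++⁻ (map (a ∷_) (compositionsFrom 1 n)) α∈
  ... | inj₁ α∈ˡ with β , β∈ , refl ← ∈-map⁻ (a ∷_) α∈ˡ
                 with b , γ , refl , 1≤b , pos , eq ← from-sound 1 n β∈
      = a , β , refl , ≤-refl , >-nonZero 1≤b ∷ pos , cong (a +_) eq
  ... | inj₂ α∈ʳ with b , γ , refl , a<b , pos , eq ← from-sound (suc a) n α∈ʳ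
      = b , γ , refl , <⇒≤ a<b , pos , trans eq (sym (+-suc a n))

  sum≡0 : ∀ {β} → All NonZero β → sum β ≡ 0 → β ≡ []
  sum≡0 []                     eq = refl
  sum≡0 {suc _ ∷ _} (_ ∷ _) ()

  from-complete : ∀ a n {b β} → a ≤ b → All NonZero β → b + sum β ≡ a + n →
                  b ∷ β ∈ compositionsFrom a n
  from-complete a n {b} {β} a≤b pos eq with m≤n⇒m<n∨m≡n a≤b
  from-complete a zero    {b} {β} a≤b pos eq | inj₁ a<b =
    contradiction (<-≤-trans a<b (subst (b ≤_) (trans eq (+-identityʳ a)) (m≤m+n b (sum β)))) (n≮n a)
  from-complete a (suc n) {b} {β} a≤b pos eq | inj₁ a<b =
    ∈-++⁺ʳ _ (from-complete (suc a) n a<b pos (trans eq (+-suc a n)))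
  from-complete a zero    {b} {β} a≤b pos eq | inj₂ refl
    with refl ← sum≡0 pos (+-cancelˡ-≡ a _ _ eq) = here refl
  from-complete a (suc n) {b} {β} a≤b pos eq | inj₂ refl
    with β | pos | +-cancelˡ-≡ a _ _ eq
  ... | c ∷ γ | c≢0 ∷ pos′ | eq′ =
    ∈-++⁺ˡ (∈-map⁺ (a ∷_) (from-complete 1 n (>-nonZero⁻¹ c ⦃ c≢0 ⦄) pos′ eq′))

  from-unique : ∀ a n → Unique (compositionsFrom a n)
  from-unique a zero    = [] ∷ []
  from-unique a (suc n) =
    Unique.++⁺ (Unique.map⁺ ∷-injectiveʳ (from-unique 1 n)) (from-unique (suc a) n) disjoint
    where
    disjoint : ∀ {α} → ¬ (α ∈ map (a ∷_) (compositionsFrom 1 n) × α ∈ compositionsFrom (suc a) n)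
    disjoint (p , q) with _ , _ , refl ← ∈-map⁻ (a ∷_) p
                     with _ , _ , refl , a<a , _ ← from-sound (suc a) n q = n≮n a a<a

∈-compositions : ∀ {n α} → α ∈ compositions n ⇔ IsComposition n α
∈-compositions = mk⇔ (to _) (from _)
  where
  to : ∀ n {α} → α ∈ compositions n → IsComposition n α
  to zero    (here refl) = [] , refl
  to (suc n) α∈ with b , β , refl , 1≤b , pos , eq ← from-sound 1 n α∈ = >-nonZero 1≤b ∷ pos , eq
  from : ∀ n {α} → IsComposition n α → α ∈ compositions n
  from zero    (pos , eq) = here (sum≡0 pos eq)
  from (suc n) (b≢0 ∷ pos , eq) = from-complete 1 n (>-nonZero⁻¹ _ ⦃ b≢0 ⦄) pos eq

-- PComSqf d lists each square-free polycomposition of d exactly once.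
∈-PComSqf : ∀ {d δ} → δ ∈ PComSqf d ⇔ IsSquareFreePolycomposition d δ
∈-PComSqf = mk⇔
  (λ δ∈ → let α , α∈ , eq = ∈-map⁻ [_] δ∈ in α , Equivalence.to ∈-compositions α∈ , eq)
  (λ { (α , αc , refl) → ∈-map⁺ [_] (Equivalence.from ∈-compositions αc) })

PComSqf-unique : ∀ d → Unique (PComSqf d)
PComSqf-unique zero    = [] ∷ []
PComSqf-unique (suc n) = Unique.map⁺ ∷-injectiveˡ (from-unique 1 n)

------------------------------------------------------------------------
-- Monomials in the x_{i,j}

-- The exponent of x_{i+1,j+1} is the entry in row i and column j, and 0 where
-- there is no such entry. So trailing zeros and trailing empty rows are
-- immaterial, and monomials are compared by _≈ᵐ_.
Monomial : Set
Monomial = List (List ℕ)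

entry : {A : Set} → A → List A → ℕ → A
entry ε []       _       = ε
entry ε (x ∷ _)  zero    = x
entry ε (_ ∷ xs) (suc i) = entry ε xs i

exponent : Monomial → ℕ → ℕ → ℕ
exponent m i j = entry 0 (entry [] m i) j

infix 4 _≈ᵐ_ _≈ᵐ?_

_≈ᵐ_ : Rel Monomial 0ℓ
m ≈ᵐ n = ∀ i j → exponent m i j ≡ exponent n i j

private
  cons : {Q : ℕ → Set} → Q 0 × (∀ i → Q (suc i)) → ∀ i → Q i
  cons (q₀ , _)  zero    = q₀
  cons (_  , q₊) (suc i) = q₊ i

  uncons : {Q : ℕ → Set} → (∀ i → Q i) → Q 0 × (∀ i → Q (suc i))
  uncons q = q 0 , q ∘ suc

module _ {A : Set} (ε : A) {_∼_ : Rel A 0ℓ} (_∼?_ : Decidable _∼_) where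

  entries? : Decidable (λ xs ys → ∀ i → entry ε xs i ∼ entry ε ys i)
  entries? []       []       = map′ (λ p _ → p) (λ f → f 0) (ε ∼? ε)
  entries? []       (y ∷ ys) = map′ cons uncons (ε ∼? y ×-dec entries? [] ys)
  entries? (x ∷ xs) []       = map′ cons uncons (x ∼? ε ×-dec entries? xs [])
  entries? (x ∷ xs) (y ∷ ys) = map′ cons uncons (x ∼? y ×-dec entries? xs ys)

_≈ᵐ?_ : Decidable _≈ᵐ_
_≈ᵐ?_ = entries? [] (entries? 0 _≟_)

-- x_{i+1,j+1}^e
xPower : ℕ → ℕ → ℕ → Monomial
xPower i j e = replicate i [] ++ [ replicate j 0 ++ [ e ] ]

-- The degree when the first row has the indeterminates of degree w.
degFrom : ℕ → Monomial → ℕ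
degFrom w []        = 0
degFrom w (row ∷ m) = w * sum row + degFrom (suc w) m

deg : Monomial → ℕ
deg = degFrom 1

SquareFree : Monomial → Set
SquareFree = All (All (_≤ 1))

squareFree? : Decidable₁ SquareFree
squareFree? = all? (all? (_≤? 1))

numVars : Monomial → ℕ
numVars m = length (filter (0 <?_) (concat m))

-- x_{i,j} does not occur in m when j > columns m.
columns : Monomial → ℕ
columns = foldr (λ row c → length row ⊔ c) 0

-- All pairs (a , b) with a · b = m, each once. Both factors are given the
-- shape of m, which loses nothing as every indeterminate of a factor occurs in m.
splitExponent : ℕ → List (ℕ × ℕ)
splitExponent e = map (λ a → a , e ∸ a) (upTo (suc e))

splitEntries : {A : Set} → (A → List (A × A)) → List A → List (List A × List A)
splitEntries split []       = [ [] , [] ]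
splitEntries split (x ∷ xs) =
  cartesianProductWith (zip′ _∷_ _∷_) (split x) (splitEntries split xs)

factorisations : Monomial → List (Monomial × Monomial)
factorisations = splitEntries (splitEntries splitExponent)

------------------------------------------------------------------------
-- Power series in the x_{i,j} over ℚ

-- The coefficient of each monomial.
Series : Set
Series = Monomial → ℚ

infix 4 _≈ˢ_

_≈ˢ_ : Rel Series 0ℓ
f ≈ˢ g = ∀ m → f m ≡ g m

∑ℚ : {A : Set} → List A → (A → ℚ) → ℚ
∑ℚ xs f = foldr (λ x s → f x ℚ.+ s) 0ℚ xs

∑ˢ : {A : Set} → List A → (A → Series) → Series
∑ˢ xs f m = ∑ℚ xs (λ x → f x m)

syntax ∑ˢ xs (λ x → f) = ∑[ x ∈ xs ] f

infix  2 ∑ˢ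
infixr 7 _•_
infixl 7 _*ˢ_

fromℤ : ℤ → ℚ
fromℤ z = z ℚ./ 1

_•_ : ℤ → Series → Series
(z • f) m = fromℤ z ℚ.* f m

𝟙[_] : {A : Set} → Dec A → ℚ
𝟙[ a? ] = if does a? then 1ℚ else 0ℚ

1ˢ : Series
1ˢ m = 𝟙[ m ≈ᵐ? [] ]

_*ˢ_ : Series → Series → Series
(f *ˢ g) m = ∑ℚ (factorisations m) (λ (a , b) → f a ℚ.* g b)

-- Replacing each x_{i,j} by x_{i,j}^r: the monomials that occur are the r-th
-- powers n^r, with the coefficient of n in f.
infix 8 _⟨_⟩

_⟨_⟩ : Series → (r : ℕ) ⦃ _ : NonZero r ⦄ → Series
(f ⟨ r ⟩) m = if does (all? (all? (r ∣?_)) m) then f (map (map (_/ r)) m) else 0ℚ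

H : ℕ → Series
H d m = 𝟙[ deg m ≟ d ]

E : ℕ → Series
E d m = 𝟙[ squareFree? m ×-dec deg m ≟ d ] ℚ.* fromℤ (-1ℤ ℤ.^ numVars m)

-- Σ_{j≥1} x_{i+1,j}^e for e ≥ 1. The terms with j > columns m do not contribute
-- to the coefficient of m.
powerSum : ℕ → ℕ → Series
powerSum i e m = ∑ℚ (upTo (columns m)) (λ j → 𝟙[ m ≈ᵐ? xPower i j e ])

-- The i for which i + 1 is a divisor of d ≥ 1.
predDivisors : ℕ → List ℕ
predDivisors d = filter (λ i → suc i ∣? d) (upTo d)

P : ℕ → Series
P d = ∑[ i ∈ predDivisors d ] ((ℤ.+ suc i) • powerSum i (d / suc i))

-- F_δ, for F = H or E.
infix 8 _⟪_⟫

_⟪_⟫ : (ℕ → Series) → Polycomposition → Series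
F ⟪ δ ⟫ = foldr _*ˢ_ 1ˢ (map (λ b → F (Block.degree b) ⟨ Block.multiplicity b ⟩) (blocks δ))

{-# OPTIONS --safe #-}

module Submission where

-- Let F be H (s = 1) or E (s = −1). Splitting off the first part of α reduces
-- both identities to Newton's identity
--   F_0 P_d + F_1 P_{d−1} + ⋯ + F_{d−1} P_1 = s d F_d.
-- The coefficient of m in F_k is h(m) if deg m = k, where h is multiplicative over
-- the indeterminates, and the coefficient of b in P_n is i if b = x_{i,j}^e with
-- i e = n and e ≥ 1. So at m of degree d the left-hand side is the sum over all
-- divisors x_{i,j}^e ≠ 1 of m of i h(m / x_{i,j}^e). For one exponent x one
-- checks Σ_{a<x} h(a) = s x h(x), and the Leibniz rule over the indeterminates
-- turns this into s (deg m) h(m).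

open import Defs
open import Data.Bool.Base using (true; false; if_then_else_)
import Data.Integer.Base as ℤ
import Data.Integer.Properties as ℤ
open import Data.List.Base
  using (List; []; _∷_; [_]; _++_; map; concat; filter; length; replicate; upTo;
         cartesianProductWith)
open import Data.List.Membership.Propositional using (_∈_)
open import Data.List.Membership.Propositional.Properties
  using (∈-map⁻; ∈-upTo⁻; ∈-filter⁻; ∈-cartesianProductWith⁻)
open import Data.List.Properties using (map-upTo; filter-++; length-++; map-id-local)
open import Data.List.Relation.Unary.All as All using (All; []; _∷_; all?)
open import Data.List.Relation.Unary.Any using (here; there)
open import Data.Nat.Base
  using (ℕ; zero; suc; _+_; _∸_; _/_; _≤_; _<_; z≤n; s≤s; NonZero; z<s; s≤s⁻¹; >-nonZero)
open import Data.Nat.Divisibility using (_∣_; _∣?_; 1∣_; m∣m*n; ∣⇒≤; >⇒∤)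
open import Data.Nat.DivMod using (n/1≡n; m*[n/m]≡n; m≥n⇒m/n>0)
open import Data.Nat.ListAction using (sum)
import Data.Nat.Base as ℕ using (_*_)
import Data.Nat.Properties as ℕ
import Algebra.Properties.CommutativeSemigroup ℕ.+-commutativeSemigroup as +-CS
open import Data.Product.Base using (_×_; _,_; proj₂; zip′)
open import Data.Rational.Base as ℚ using (ℚ; 0ℚ; 1ℚ; toℚᵘ)
import Data.Rational.Properties as ℚ
import Algebra.Properties.Group ℚ.+-0-group as +-G
open import Data.Rational.Solver using (module +-*-Solver)
import Data.Rational.Unnormalised.Base as ℚᵘ
import Data.Rational.Unnormalised.Properties as ℚᵘ
open import Data.Sum.Base using (inj₁; inj₂)
open import Function.Base using (_∘_)
open import Function.Bundles using (Equivalence)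
open import Relation.Binary.Definitions using (Decidable)
open import Relation.Binary.PropositionalEquality
  using (_≡_; refl; sym; trans; cong; cong₂; subst; module ≡-Reasoning)
open import Relation.Nullary.Decidable using (Dec; yes; no; does; dec-true; dec-false; _×-dec_)
open import Relation.Nullary.Negation using (¬_; contradiction)
open import Relation.Unary using () renaming (Decidable to Decidable₁)
open +-*-Solver

-- The constant `s` comes from a logarithmic derivative. Let h(t) = Σ h(x) t^x, which is 1/(1-t) for
-- `H` and 1-t for `E`. The identity for one exponent says h(t)·t/(1-t) = s·t·h′(t). The two series
-- are inverse to each other, hence the opposite signs.
--
-- The degree tests in `F d` and `P n` do not split over the entries of a monomial. The degree-free
-- functions `Π (Π h)` and `powers` do. So convolutions are computed for these, and a single degree
-- test on the whole monomial is put back, degrees being additive along factorisations.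
--
-- Compositions and Newton's identity are linked by an interpolation: the signed sum over the
-- compositions of a + n with first part at least a, plus F_a P_n + ⋯ + F_{a+n-1} P_1, depends only
-- on a + n. At n = 0 it is s a F_a; at a = 1 it is compared with Newton's identity, and the common
-- terms cancel.

fromℤ-+ : ∀ i j → fromℤ (i ℤ.+ j) ≡ fromℤ i ℚ.+ fromℤ j
-- `z ℚ./ 1` normalises and is stuck on a variable `z`, so the equation is checked on unnormalised
-- fractions with denominator 1.
fromℤ-+ i j = ℚ.toℚᵘ-injective (begin-equality
  toℚᵘ (fromℤ (i ℤ.+ j))             ≃⟨ ℚ.toℚᵘ-fromℚᵘ (ℚᵘ.mkℚᵘ (i ℤ.+ j) 0) ⟩
  ℚᵘ.mkℚᵘ (i ℤ.+ j) 0                ≃⟨ ℚᵘ.*≡* (cong (ℤ._* ℤ.1ℤ)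
                                          (sym (cong₂ ℤ._+_ (ℤ.*-identityʳ i) (ℤ.*-identityʳ j)))) ⟩
  ℚᵘ.mkℚᵘ i 0 ℚᵘ.+ ℚᵘ.mkℚᵘ j 0       ≃⟨ ℚᵘ.+-cong (ℚ.toℚᵘ-fromℚᵘ (ℚᵘ.mkℚᵘ i 0)) (ℚ.toℚᵘ-fromℚᵘ (ℚᵘ.mkℚᵘ j 0)) ⟨
  toℚᵘ (fromℤ i) ℚᵘ.+ toℚᵘ (fromℤ j) ≃⟨ ℚ.toℚᵘ-homo-+ (fromℤ i) (fromℤ j) ⟨
  toℚᵘ (fromℤ i ℚ.+ fromℤ j)         ∎)
  where open ℚᵘ.≤-Reasoning

fromℤ-* : ∀ i j → fromℤ (i ℤ.* j) ≡ fromℤ i ℚ.* fromℤ j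
fromℤ-* i j = ℚ.toℚᵘ-injective (begin-equality
  toℚᵘ (fromℤ (i ℤ.* j))             ≃⟨ ℚ.toℚᵘ-fromℚᵘ (ℚᵘ.mkℚᵘ (i ℤ.* j) 0) ⟩
  ℚᵘ.mkℚᵘ i 0 ℚᵘ.* ℚᵘ.mkℚᵘ j 0       ≃⟨ ℚᵘ.*-cong (ℚ.toℚᵘ-fromℚᵘ (ℚᵘ.mkℚᵘ i 0)) (ℚ.toℚᵘ-fromℚᵘ (ℚᵘ.mkℚᵘ j 0)) ⟨
  toℚᵘ (fromℤ i) ℚᵘ.* toℚᵘ (fromℤ j) ≃⟨ ℚ.toℚᵘ-homo-* (fromℤ i) (fromℤ j) ⟨
  toℚᵘ (fromℤ i ℚ.* fromℤ j)         ∎)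
  where open ℚᵘ.≤-Reasoning

fromℕ : ℕ → ℚ
fromℕ n = fromℤ (ℤ.+ n)

fromℕ-+ : ∀ m n → fromℕ (m + n) ≡ fromℕ m ℚ.+ fromℕ n
fromℕ-+ m n = fromℤ-+ (ℤ.+ m) (ℤ.+ n)

fromℕ-* : ∀ m n → fromℕ (m ℕ.* n) ≡ fromℕ m ℚ.* fromℕ n
fromℕ-* m n = trans (cong fromℤ (ℤ.pos-* m n)) (fromℤ-* (ℤ.+ m) (ℤ.+ n))

open ≡-Reasoning

private variable
  A B C : Set

-- Sums and indicators

-- Unlike ∑ℚ, a fold that Agda unfolds at once, this lets the summand be inferred.
∑ : List A → (A → ℚ) → ℚ
∑ []       f = 0ℚ
∑ (x ∷ xs) f = f x ℚ.+ ∑ xs f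

∑ℚ≡∑ : ∀ (xs : List A) f → ∑ℚ xs f ≡ ∑ xs f
∑ℚ≡∑ []       f = refl
∑ℚ≡∑ (x ∷ xs) f = cong (f x ℚ.+_) (∑ℚ≡∑ xs f)

∑-cong : ∀ (xs : List A) {f g : A → ℚ} → (∀ {x} → x ∈ xs → f x ≡ g x) → ∑ xs f ≡ ∑ xs g
∑-cong []       eq = refl
∑-cong (x ∷ xs) eq = cong₂ ℚ._+_ (eq (here refl)) (∑-cong xs (eq ∘ there))

∑-0 : ∀ (xs : List A) → ∑ xs (λ _ → 0ℚ) ≡ 0ℚ
∑-0 []       = refl
∑-0 (x ∷ xs) = trans (ℚ.+-identityˡ (∑ xs _)) (∑-0 xs)

∑-zero : ∀ (xs : List A) {f : A → ℚ} → (∀ {x} → x ∈ xs → f x ≡ 0ℚ) → ∑ xs f ≡ 0ℚ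
∑-zero xs eq = trans (∑-cong xs eq) (∑-0 xs)

∑-++ : ∀ (xs ys : List A) {f : A → ℚ} → ∑ (xs ++ ys) f ≡ ∑ xs f ℚ.+ ∑ ys f
∑-++ []       ys {f} = sym (ℚ.+-identityˡ (∑ ys f))
∑-++ (x ∷ xs) ys {f} = trans (cong (f x ℚ.+_) (∑-++ xs ys)) (sym (ℚ.+-assoc (f x) (∑ xs f) (∑ ys f)))

∑-map : ∀ (g : A → B) (xs : List A) (f : B → ℚ) → ∑ (map g xs) f ≡ ∑ xs (f ∘ g)
∑-map g []       f = refl
∑-map g (x ∷ xs) f = cong (f (g x) ℚ.+_) (∑-map g xs f)

∑-+ : ∀ (xs : List A) {f g : A → ℚ} → ∑ xs (λ x → f x ℚ.+ g x) ≡ ∑ xs f ℚ.+ ∑ xs g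
∑-+ []               = refl
∑-+ (x ∷ xs) {f} {g} = trans (cong (f x ℚ.+ g x ℚ.+_) (∑-+ xs))
  (solve 4 (λ a b c d → (a :+ b) :+ (c :+ d) := (a :+ c) :+ (b :+ d)) refl
    (f x) (g x) (∑ xs f) (∑ xs g))

*-∑ : ∀ c (xs : List A) {f : A → ℚ} → c ℚ.* ∑ xs f ≡ ∑ xs (λ x → c ℚ.* f x)
*-∑ c []           = ℚ.*-zeroʳ c
*-∑ c (x ∷ xs) {f} = trans (ℚ.*-distribˡ-+ c (f x) (∑ xs f)) (cong (c ℚ.* f x ℚ.+_) (*-∑ c xs))

∑-swap : ∀ (xs : List A) (ys : List B) {f : A → B → ℚ} →
         ∑ xs (λ x → ∑ ys (f x)) ≡ ∑ ys (λ y → ∑ xs (λ x → f x y))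
∑-swap []       ys     = sym (∑-0 ys)
∑-swap (x ∷ xs) ys {f} = trans (cong (∑ ys (f x) ℚ.+_) (∑-swap xs ys)) (sym (∑-+ ys))

∑-upTo-suc : ∀ n (f : ℕ → ℚ) → ∑ (upTo (suc n)) f ≡ f 0 ℚ.+ ∑ (upTo n) (f ∘ suc)
∑-upTo-suc n f = cong (f 0 ℚ.+_)
  (trans (cong (λ xs → ∑ xs f) (sym (map-upTo suc n))) (∑-map suc (upTo n) f))

∑-product : ∀ (g : A → B → C) (xs : List A) (ys : List B) {f} (u : A → ℚ) (v : B → ℚ) →
            (∀ x y → f (g x y) ≡ u x ℚ.* v y) →
            ∑ (cartesianProductWith g xs ys) f ≡ ∑ xs u ℚ.* ∑ ys v
∑-product g []       ys     u v eq = sym (ℚ.*-zeroˡ (∑ ys v))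
∑-product g (x ∷ xs) ys {f} u v eq = begin
  ∑ (map (g x) ys ++ cartesianProductWith g xs ys) f
    ≡⟨ ∑-++ (map (g x) ys) (cartesianProductWith g xs ys) ⟩
  ∑ (map (g x) ys) f ℚ.+ ∑ (cartesianProductWith g xs ys) f
    ≡⟨ cong₂ ℚ._+_ (trans (∑-map (g x) ys f) (trans (∑-cong ys (λ _ → eq x _)) (sym (*-∑ (u x) ys))))
                   (∑-product g xs ys u v eq) ⟩
  u x ℚ.* ∑ ys v ℚ.+ ∑ xs u ℚ.* ∑ ys v
    ≡⟨ ℚ.*-distribʳ-+ (∑ ys v) (u x) (∑ xs u) ⟨
  (u x ℚ.+ ∑ xs u) ℚ.* ∑ ys v ∎

𝟙-yes : ∀ {X : Set} (x? : Dec X) → X → 𝟙[ x? ] ≡ 1ℚ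
𝟙-yes x? x = cong (if_then 1ℚ else 0ℚ) (dec-true x? x)

𝟙-no : ∀ {X : Set} (x? : Dec X) → ¬ X → 𝟙[ x? ] ≡ 0ℚ
𝟙-no x? ¬x = cong (if_then 1ℚ else 0ℚ) (dec-false x? ¬x)

𝟙-cong : ∀ {X Y : Set} (x? : Dec X) (y? : Dec Y) → (X → Y) → (Y → X) → 𝟙[ x? ] ≡ 𝟙[ y? ]
𝟙-cong (yes x) y? to from = sym (𝟙-yes y? (to x))
𝟙-cong (no ¬x) y? to from = sym (𝟙-no y? (¬x ∘ from))

𝟙-× : ∀ {X Y : Set} (x? : Dec X) (y? : Dec Y) → 𝟙[ x? ×-dec y? ] ≡ 𝟙[ x? ] ℚ.* 𝟙[ y? ]
𝟙-× x? y? with does x?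
... | true  = sym (ℚ.*-identityˡ 𝟙[ y? ])
... | false = sym (ℚ.*-zeroˡ 𝟙[ y? ])

∑-filter : ∀ {Q : A → Set} (Q? : Decidable₁ Q) (xs : List A) {f : A → ℚ} →
           ∑ (filter Q? xs) f ≡ ∑ xs (λ x → 𝟙[ Q? x ] ℚ.* f x)
∑-filter Q? []           = refl
∑-filter Q? (x ∷ xs) {f} with does (Q? x)
... | true  = cong₂ ℚ._+_ (sym (ℚ.*-identityˡ (f x))) (∑-filter Q? xs)
... | false = trans (∑-filter Q? xs) (sym (trans (cong (ℚ._+ rest) (ℚ.*-zeroˡ (f x))) (ℚ.+-identityˡ rest)))
  where rest = ∑ xs (λ x → 𝟙[ Q? x ] ℚ.* f x)

-- Convolution of multiplicative functions with derivations

Π : (A → ℚ) → List A → ℚ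
Π h []       = 1ℚ
Π h (x ∷ xs) = h x ℚ.* Π h xs

-- The terms of the Leibniz rule: p acts on one entry, h on the others. The
-- first entry is at position w.
leibniz : (A → ℚ) → (ℕ → A → ℚ) → ℕ → List A → ℚ
leibniz h p w []       = 0ℚ
leibniz h p w (x ∷ xs) = p w x ℚ.* Π h xs ℚ.+ h x ℚ.* leibniz h p (suc w) xs

convolve : (A → List (A × A)) → (A → ℚ) → (A → ℚ) → A → ℚ
convolve split f g x = ∑ (split x) (λ (a , b) → f a ℚ.* g b)

*-interchange : ∀ a b c d → (a ℚ.* b) ℚ.* (c ℚ.* d) ≡ (a ℚ.* c) ℚ.* (b ℚ.* d)
*-interchange = solve 4 (λ a b c d → (a :* b) :* (c :* d) := (a :* c) :* (b :* d)) refl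

*-swap : ∀ a b c → a ℚ.* (b ℚ.* c) ≡ b ℚ.* (a ℚ.* c)
*-swap = solve 3 (λ a b c → a :* (b :* c) := b :* (a :* c)) refl

module _ {split : A → List (A × A)} {h u : A → ℚ} (unit : ∀ x → convolve split h u x ≡ h x) where

  -- A list is factorised entry by entry and independently, so the sum is a product of one
  -- convolution per entry.
  convolve-Π : ∀ xs → convolve (splitEntries split) (Π h) (Π u) xs ≡ Π h xs
  convolve-Π []       = refl
  convolve-Π (x ∷ xs) = begin
    convolve (splitEntries split) (Π h) (Π u) (x ∷ xs)
      ≡⟨ ∑-product (zip′ _∷_ _∷_) (split x) (splitEntries split xs)
           (λ (a , b) → h a ℚ.* u b) (λ (as , bs) → Π h as ℚ.* Π u bs)
           (λ (a , b) (as , bs) → *-interchange (h a) (Π h as) (u b) (Π u bs)) ⟩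
    convolve split h u x ℚ.* convolve (splitEntries split) (Π h) (Π u) xs
      ≡⟨ cong₂ ℚ._*_ (unit x) (convolve-Π xs) ⟩
    Π h (x ∷ xs) ∎

  -- In each Leibniz term the entry that `p` acts on contributes `h` convolved with `p`, and every
  -- other entry contributes `h` convolved with `u`, which is `h` again. This serves at both levels:
  -- exponents in a row, and rows in a monomial.
  convolve-leibniz : ∀ {p q : ℕ → A → ℚ} → (∀ w x → convolve split h (p w) x ≡ q w x) →
    ∀ w xs → convolve (splitEntries split) (Π h) (leibniz u p w) xs ≡ leibniz h q w xs
  convolve-leibniz         entry w []       = refl
  convolve-leibniz {p} {q} entry w (x ∷ xs) = begin
    ∑ ss (λ (as , bs) → Π h as ℚ.* leibniz u p w bs)
      ≡⟨ ∑-cong ss (λ {(as , bs)} _ → expand as bs) ⟩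
    ∑ ss (λ ab → first ab ℚ.+ rest ab)
      ≡⟨ ∑-+ ss ⟩
    ∑ ss first ℚ.+ ∑ ss rest
      ≡⟨ cong₂ ℚ._+_
           (∑-product (zip′ _∷_ _∷_) (split x) (splitEntries split xs)
             (λ (a , b) → h a ℚ.* p w b) (λ (as , bs) → Π h as ℚ.* Π u bs)
             (λ (a , b) (as , bs) → *-interchange (h a) (Π h as) (p w b) (Π u bs)))
           (∑-product (zip′ _∷_ _∷_) (split x) (splitEntries split xs)
             (λ (a , b) → h a ℚ.* u b) (λ (as , bs) → Π h as ℚ.* leibniz u p (suc w) bs)
             (λ (a , b) (as , bs) → *-interchange (h a) (Π h as) (u b) (leibniz u p (suc w) bs))) ⟩
    convolve split h (p w) x ℚ.* convolve (splitEntries split) (Π h) (Π u) xs ℚ.+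
    convolve split h u x ℚ.* convolve (splitEntries split) (Π h) (leibniz u p (suc w)) xs
      ≡⟨ cong₂ ℚ._+_ (cong₂ ℚ._*_ (entry w x) (convolve-Π xs))
                     (cong₂ ℚ._*_ (unit x) (convolve-leibniz entry (suc w) xs)) ⟩
    leibniz h q w (x ∷ xs) ∎
    where
    ss = splitEntries split (x ∷ xs)
    first rest : List A × List A → ℚ
    -- No pair in `ss` has an empty second component. The default 0 agrees with `leibniz` on the
    -- empty list, so `expand` can be stated for all pairs.
    first (as , [])     = 0ℚ
    first (as , b ∷ bs) = Π h as ℚ.* (p w b ℚ.* Π u bs)
    rest (as , [])     = 0ℚ
    rest (as , b ∷ bs) = Π h as ℚ.* (u b ℚ.* leibniz u p (suc w) bs)
    expand : ∀ as bs → Π h as ℚ.* leibniz u p w bs ≡ first (as , bs) ℚ.+ rest (as , bs)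
    expand as []       = ℚ.*-zeroʳ (Π h as)
    expand as (b ∷ bs) = ℚ.*-distribˡ-+ (Π h as) (p w b ℚ.* Π u bs) (u b ℚ.* leibniz u p (suc w) bs)

leibniz-cong : ∀ {h : A → ℚ} {p q : ℕ → A → ℚ} → (∀ w x → p w x ≡ q w x) →
               ∀ w xs → leibniz h p w xs ≡ leibniz h q w xs
leibniz-cong         eq w []       = refl
leibniz-cong {h = h} eq w (x ∷ xs) =
  cong₂ ℚ._+_ (cong (ℚ._* Π h xs) (eq w x)) (cong (h x ℚ.*_) (leibniz-cong eq (suc w) xs))

-- This is Euler's identity: when acting on an entry only multiplies `h` by `s` times a weight,
-- every Leibniz term is a multiple of `Π h xs`, and the weights add up to `D`.
leibniz-degree : ∀ {h : A → ℚ} s (d : ℕ → A → ℕ) (D : ℕ → List A → ℕ) →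
  (∀ w → D w [] ≡ 0) → (∀ w x xs → D w (x ∷ xs) ≡ d w x + D (suc w) xs) →
  ∀ w xs → leibniz h (λ w x → s ℚ.* fromℕ (d w x) ℚ.* h x) w xs ≡ s ℚ.* fromℕ (D w xs) ℚ.* Π h xs
leibniz-degree s d D D[] D∷ w [] = sym (begin
  s ℚ.* fromℕ (D w []) ℚ.* 1ℚ ≡⟨ cong (λ n → s ℚ.* fromℕ n ℚ.* 1ℚ) (D[] w) ⟩
  s ℚ.* 0ℚ ℚ.* 1ℚ             ≡⟨ trans (ℚ.*-identityʳ (s ℚ.* 0ℚ)) (ℚ.*-zeroʳ s) ⟩
  0ℚ ∎)
leibniz-degree {h = h} s d D D[] D∷ w (x ∷ xs) = begin
  s ℚ.* fromℕ (d w x) ℚ.* h x ℚ.* Π h xs ℚ.+ h x ℚ.* leibniz h _ (suc w) xs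
    ≡⟨ cong (λ r → s ℚ.* fromℕ (d w x) ℚ.* h x ℚ.* Π h xs ℚ.+ h x ℚ.* r)
         (leibniz-degree s d D D[] D∷ (suc w) xs) ⟩
  s ℚ.* fromℕ (d w x) ℚ.* h x ℚ.* Π h xs ℚ.+ h x ℚ.* (s ℚ.* fromℕ (D (suc w) xs) ℚ.* Π h xs)
    ≡⟨ solve 5 (λ s d D h H → s :* d :* h :* H :+ h :* (s :* D :* H) := s :* (d :+ D) :* (h :* H)) refl
         s (fromℕ (d w x)) (fromℕ (D (suc w) xs)) (h x) (Π h xs) ⟩
  s ℚ.* (fromℕ (d w x) ℚ.+ fromℕ (D (suc w) xs)) ℚ.* Π h (x ∷ xs)
    ≡⟨ cong (λ n → s ℚ.* n ℚ.* Π h (x ∷ xs))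
         (trans (sym (fromℕ-+ (d w x) (D (suc w) xs))) (cong fromℕ (sym (D∷ w x xs)))) ⟩
  s ℚ.* fromℕ (D w (x ∷ xs)) ℚ.* Π h (x ∷ xs) ∎

-- Leibniz terms at a given position, and indicators of lists with one nontrivial entry

length≤columns : ∀ {row} {m : Monomial} → row ∈ m → length row ≤ columns m
length≤columns {row} {_ ∷ m} (here refl) = ℕ.m≤m⊔n (length row) (columns m)
length≤columns {row} {r ∷ m} (there row∈) = ℕ.≤-trans (length≤columns row∈) (ℕ.m≤n⊔m (length r) (columns m))

∑-upTo-+ : ∀ n k {f : ℕ → ℚ} → (∀ i → f (n + i) ≡ 0ℚ) → ∑ (upTo (n + k)) f ≡ ∑ (upTo n) f
∑-upTo-+ zero    k     eq = ∑-zero (upTo k) (λ {i} _ → eq i)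
∑-upTo-+ (suc n) k {f} eq = begin
  ∑ (upTo (suc n + k)) f               ≡⟨ ∑-upTo-suc (n + k) f ⟩
  f 0 ℚ.+ ∑ (upTo (n + k)) (f ∘ suc)   ≡⟨ cong (f 0 ℚ.+_) (∑-upTo-+ n k eq) ⟩
  f 0 ℚ.+ ∑ (upTo n) (f ∘ suc)         ≡⟨ ∑-upTo-suc n f ⟨
  ∑ (upTo (suc n)) f                   ∎

Π-cong : ∀ (xs : List A) {h k : A → ℚ} → (∀ x → h x ≡ k x) → Π h xs ≡ Π k xs
Π-cong []       eq = refl
Π-cong (x ∷ xs) eq = cong₂ ℚ._*_ (eq x) (Π-cong xs eq)

Π-𝟙 : ∀ {Q : A → Set} (Q? : Decidable₁ Q) xs → Π (λ x → 𝟙[ Q? x ]) xs ≡ 𝟙[ all? Q? xs ]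
Π-𝟙 Q? []       = refl
Π-𝟙 Q? (x ∷ xs) = trans (cong (𝟙[ Q? x ] ℚ.*_) (Π-𝟙 Q? xs)) (sym (𝟙-× (Q? x) (all? Q? xs)))

Π-one : ∀ {h : A → ℚ} {xs} → All (λ x → h x ≡ 1ℚ) xs → Π h xs ≡ 1ℚ
Π-one []         = refl
Π-one (eq ∷ eqs) = cong₂ ℚ._*_ eq (Π-one eqs)

leibniz-zero : ∀ {h : A → ℚ} {p : ℕ → A → ℚ} {xs} → All (λ x → ∀ w → p w x ≡ 0ℚ) xs →
               ∀ w → leibniz h p w xs ≡ 0ℚ
leibniz-zero                            []         w = refl
leibniz-zero {h = h} {p} {xs = x ∷ xs} (eq ∷ eqs) w = begin
  p w x ℚ.* Π h xs ℚ.+ h x ℚ.* leibniz h p (suc w) xs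
    ≡⟨ cong₂ (λ a b → a ℚ.* Π h xs ℚ.+ h x ℚ.* b) (eq w) (leibniz-zero eqs (suc w)) ⟩
  0ℚ ℚ.* Π h xs ℚ.+ h x ℚ.* 0ℚ
    ≡⟨ cong₂ ℚ._+_ (ℚ.*-zeroˡ (Π h xs)) (ℚ.*-zeroʳ (h x)) ⟩
  0ℚ ∎

-- The term of leibniz in which q acts on the entry i.
single : (A → ℚ) → (A → ℚ) → ℕ → List A → ℚ
single h q i       []       = 0ℚ
single h q zero    (x ∷ xs) = q x ℚ.* Π h xs
single h q (suc i) (x ∷ xs) = h x ℚ.* single h q i xs

single-cong : ∀ {h k q r : A → ℚ} → (∀ x → h x ≡ k x) → ∀ i xs → (∀ {x} → x ∈ xs → q x ≡ r x) →
              single h q i xs ≡ single k r i xs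
single-cong h≡k i       []       q≡r = refl
single-cong h≡k zero    (x ∷ xs) q≡r = cong₂ ℚ._*_ (q≡r (here refl)) (Π-cong xs h≡k)
single-cong h≡k (suc i) (x ∷ xs) q≡r = cong₂ ℚ._*_ (h≡k x) (single-cong h≡k i xs (q≡r ∘ there))

*-single : ∀ c {h q : A → ℚ} i xs → c ℚ.* single h q i xs ≡ single h (λ x → c ℚ.* q x) i xs
*-single c         i       []       = ℚ.*-zeroʳ c
*-single c {h} {q} zero    (x ∷ xs) = sym (ℚ.*-assoc c (q x) (Π h xs))
*-single c {h} {q} (suc i) (x ∷ xs) =
  trans (solve 3 (λ c a b → c :* (a :* b) := a :* (c :* b)) refl c (h x) (single h q i xs))
        (cong (h x ℚ.*_) (*-single c i xs))

∑-single : ∀ (ys : List B) {h : A → ℚ} {q : B → A → ℚ} i xs →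
           ∑ ys (λ y → single h (q y) i xs) ≡ single h (λ x → ∑ ys (λ y → q y x)) i xs
∑-single ys             i       []       = ∑-0 ys
∑-single ys {h} {q}     zero    (x ∷ xs) = begin
  ∑ ys (λ y → q y x ℚ.* Π h xs)   ≡⟨ ∑-cong ys (λ {y} _ → ℚ.*-comm (q y x) (Π h xs)) ⟩
  ∑ ys (λ y → Π h xs ℚ.* q y x)   ≡⟨ *-∑ (Π h xs) ys ⟨
  Π h xs ℚ.* ∑ ys (λ y → q y x)   ≡⟨ ℚ.*-comm (Π h xs) (∑ ys (λ y → q y x)) ⟩
  ∑ ys (λ y → q y x) ℚ.* Π h xs   ∎
∑-single ys {h} {q} (suc i) (x ∷ xs) =
  trans (sym (*-∑ (h x) ys)) (cong (h x ℚ.*_) (∑-single ys i xs))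

-- The bound `n` may exceed the length, as `single` is 0 past the end. This lets all rows of a
-- monomial share one range of columns.
leibniz-∑ : ∀ {h : A → ℚ} {p : ℕ → A → ℚ} w xs n → length xs ≤ n →
            ∑ (upTo n) (λ j → single h (p (w + j)) j xs) ≡ leibniz h p w xs
leibniz-∑         w []       n       le       = ∑-0 (upTo n)
leibniz-∑ {h = h} {p} w (x ∷ xs) (suc n) (s≤s le) = begin
  ∑ (upTo (suc n)) (λ j → single h (p (w + j)) j (x ∷ xs))
    ≡⟨ ∑-upTo-suc n (λ j → single h (p (w + j)) j (x ∷ xs)) ⟩
  p (w + 0) x ℚ.* Π h xs ℚ.+ ∑ (upTo n) (λ j → h x ℚ.* single h (p (w + suc j)) j xs)
    ≡⟨ cong₂ (λ v r → p v x ℚ.* Π h xs ℚ.+ r) (ℕ.+-identityʳ w) (sym (*-∑ (h x) (upTo n))) ⟩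
  p w x ℚ.* Π h xs ℚ.+ h x ℚ.* ∑ (upTo n) (λ j → single h (p (w + suc j)) j xs)
    ≡⟨ cong (λ r → p w x ℚ.* Π h xs ℚ.+ h x ℚ.* r)
         (trans (∑-cong (upTo n) (λ {j} _ → cong (λ v → single h (p v) j xs) (ℕ.+-suc w j)))
                (leibniz-∑ (suc w) xs n le)) ⟩
  leibniz h p w (x ∷ xs) ∎

module _ {ε : A} {_∼_ : A → A → Set} (_∼?_ : Decidable _∼_) (ε∼ε : 𝟙[ ε ∼? ε ] ≡ 1ℚ) where

  𝟙-entries-unit : ∀ xs → 𝟙[ entries? ε _∼?_ xs [] ] ≡ Π (λ x → 𝟙[ x ∼? ε ]) xs
  𝟙-entries-unit []       = ε∼ε
  𝟙-entries-unit (x ∷ xs) = trans (𝟙-× (x ∼? ε) (entries? ε _∼?_ xs []))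
                                  (cong (𝟙[ x ∼? ε ] ℚ.*_) (𝟙-entries-unit xs))

  -- If `xs` ends before position `i`, its entry there counts as `ε`. The hypothesis that `ε` does
  -- not match `y` then makes the indicator 0, as `single` is.
  𝟙-entries-single : ∀ {y} → 𝟙[ ε ∼? y ] ≡ 0ℚ → ∀ i xs →
    𝟙[ entries? ε _∼?_ xs (replicate i ε ++ [ y ]) ] ≡
    single (λ x → 𝟙[ x ∼? ε ]) (λ x → 𝟙[ x ∼? y ]) i xs
  𝟙-entries-single {y} ε≁y zero    []       = begin
    𝟙[ ε ∼? y ×-dec entries? ε _∼?_ [] [] ]       ≡⟨ 𝟙-× (ε ∼? y) (entries? ε _∼?_ [] []) ⟩
    𝟙[ ε ∼? y ] ℚ.* 𝟙[ entries? ε _∼?_ [] [] ]    ≡⟨ cong (ℚ._* 𝟙[ entries? ε _∼?_ [] [] ]) ε≁y ⟩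
    0ℚ ℚ.* 𝟙[ entries? ε _∼?_ [] [] ]             ≡⟨ ℚ.*-zeroˡ 𝟙[ entries? ε _∼?_ [] [] ] ⟩
    0ℚ ∎
  𝟙-entries-single {y} ε≁y (suc i) []       =
    trans (𝟙-× (ε ∼? ε) (entries? ε _∼?_ [] (replicate i ε ++ [ y ])))
      (trans (cong (𝟙[ ε ∼? ε ] ℚ.*_) (𝟙-entries-single ε≁y i [])) (ℚ.*-zeroʳ 𝟙[ ε ∼? ε ]))
  𝟙-entries-single {y} ε≁y zero    (x ∷ xs) =
    trans (𝟙-× (x ∼? y) (entries? ε _∼?_ xs []))
      (cong (𝟙[ x ∼? y ] ℚ.*_) (𝟙-entries-unit xs))
  𝟙-entries-single {y} ε≁y (suc i) (x ∷ xs) =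
    trans (𝟙-× (x ∼? ε) (entries? ε _∼?_ xs (replicate i ε ++ [ y ])))
      (cong (𝟙[ x ∼? ε ] ℚ.*_) (𝟙-entries-single ε≁y i xs))

-- Convolution on exponents

isZero isPos : ℕ → ℚ
isZero x = 𝟙[ x ℕ.≟ 0 ]
isPos  x = 𝟙[ 0 ℕ.<? x ]

convolve-suc : ∀ f g x → convolve splitExponent f g (suc x) ≡
               f 0 ℚ.* g (suc x) ℚ.+ convolve splitExponent (f ∘ suc) g x
convolve-suc f g x = begin
  convolve splitExponent f g (suc x)
    ≡⟨ ∑-map (λ a → a , suc x ∸ a) (upTo (2 + x)) (λ (a , b) → f a ℚ.* g b) ⟩
  ∑ (upTo (2 + x)) (λ a → f a ℚ.* g (suc x ∸ a))
    ≡⟨ ∑-upTo-suc (suc x) (λ a → f a ℚ.* g (suc x ∸ a)) ⟩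
  f 0 ℚ.* g (suc x) ℚ.+ ∑ (upTo (suc x)) (λ a → f (suc a) ℚ.* g (x ∸ a))
    ≡⟨ cong (f 0 ℚ.* g (suc x) ℚ.+_) (∑-map (λ a → a , x ∸ a) (upTo (suc x)) (λ (a , b) → f (suc a) ℚ.* g b)) ⟨
  f 0 ℚ.* g (suc x) ℚ.+ convolve splitExponent (f ∘ suc) g x ∎

convolve-isZeroʳ : ∀ f x → convolve splitExponent f isZero x ≡ f x
convolve-isZeroʳ f zero    = trans (ℚ.+-identityʳ (f 0 ℚ.* 1ℚ)) (ℚ.*-identityʳ (f 0))
convolve-isZeroʳ f (suc x) = begin
  convolve splitExponent f isZero (suc x)
    ≡⟨ convolve-suc f isZero x ⟩
  f 0 ℚ.* 0ℚ ℚ.+ convolve splitExponent (f ∘ suc) isZero x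
    ≡⟨ cong₂ ℚ._+_ (ℚ.*-zeroʳ (f 0)) (convolve-isZeroʳ (f ∘ suc) x) ⟩
  0ℚ ℚ.+ f (suc x)
    ≡⟨ ℚ.+-identityˡ (f (suc x)) ⟩
  f (suc x) ∎

convolve-0ˡ : ∀ g x → convolve splitExponent (λ _ → 0ℚ) g x ≡ 0ℚ
convolve-0ˡ g x = ∑-zero (splitExponent x) (λ {(_ , b)} _ → ℚ.*-zeroˡ (g b))

convolve-isZeroˡ : ∀ g x → convolve splitExponent isZero g x ≡ g x
convolve-isZeroˡ g zero    = trans (ℚ.+-identityʳ (1ℚ ℚ.* g 0)) (ℚ.*-identityˡ (g 0))
convolve-isZeroˡ g (suc x) = begin
  convolve splitExponent isZero g (suc x)
    ≡⟨ convolve-suc isZero g x ⟩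
  1ℚ ℚ.* g (suc x) ℚ.+ convolve splitExponent (λ _ → 0ℚ) g x
    ≡⟨ cong₂ ℚ._+_ (ℚ.*-identityˡ (g (suc x))) (convolve-0ˡ g x) ⟩
  g (suc x) ℚ.+ 0ℚ
    ≡⟨ ℚ.+-identityʳ (g (suc x)) ⟩
  g (suc x) ∎

-- Degrees of factorisations

sum-zero : ∀ {row} → All (_≡ 0) row → sum row ≡ 0
sum-zero []           = refl
sum-zero (refl ∷ eqs) = sum-zero eqs

zero-sum : ∀ row → sum row ≡ 0 → All (_≡ 0) row
zero-sum []           eq = []
zero-sum (zero ∷ row) eq = refl ∷ zero-sum row eq

IsOne : Monomial → Set
IsOne = All (All (_≡ 0))

isOne? : Decidable₁ IsOne
isOne? = all? (all? (ℕ._≟ 0))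

degFrom-one : ∀ {m} w → IsOne m → degFrom w m ≡ 0
degFrom-one w []           = refl
degFrom-one w (row≡0 ∷ m≡1) =
  cong₂ _+_ (trans (cong (w ℕ.*_) (sum-zero row≡0)) (ℕ.*-zeroʳ w)) (degFrom-one (suc w) m≡1)

-- The weight is a successor because a row of weight 0 would not be seen by the degree.
one-degFrom : ∀ w m → degFrom (suc w) m ≡ 0 → IsOne m
one-degFrom w []        eq = []
one-degFrom w (row ∷ m) eq =
  zero-sum row (ℕ.m+n≡0⇒m≡0 (sum row) (ℕ.m+n≡0⇒m≡0 (suc w ℕ.* sum row) eq)) ∷
  one-degFrom (suc w) m (ℕ.m+n≡0⇒n≡0 (suc w ℕ.* sum row) eq)

-- An induction principle for factorisations, used for the rows of a monomial and for the exponents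
-- of a row.
splitEntries⁺ : ∀ {split : A → List (A × A)} (R : List A → List A × List A → Set) →
  R [] ([] , []) →
  (∀ {x xs a b as bs} → (a , b) ∈ split x → R xs (as , bs) → R (x ∷ xs) (a ∷ as , b ∷ bs)) →
  ∀ xs {as bs} → (as , bs) ∈ splitEntries split xs → R xs (as , bs)
splitEntries⁺ R base step [] (here refl) = base
splitEntries⁺ {split = split} R base step (x ∷ xs) ∈ss
  with (a , b) , (as , bs) , ab∈ , asbs∈ , refl
         ← ∈-cartesianProductWith⁻ (zip′ _∷_ _∷_) (split x) (splitEntries split xs) ∈ss
  = step ab∈ (splitEntries⁺ R base step xs asbs∈)

+-split : ∀ {x a b} → (a , b) ∈ splitExponent x → a + b ≡ x
+-split {x} ab∈ with a , a∈ , refl ← ∈-map⁻ (λ a → a , x ∸ a) ab∈ =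
  ℕ.m+[n∸m]≡n (s≤s⁻¹ (∈-upTo⁻ a∈))

sum-split : ∀ row {a b} → (a , b) ∈ splitEntries splitExponent row → sum a + sum b ≡ sum row
sum-split = splitEntries⁺ (λ row (a , b) → sum a + sum b ≡ sum row) refl
  (λ {x} {xs} {a} {b} {as} {bs} ab∈ eq →
    trans (+-CS.interchange a (sum as) b (sum bs)) (cong₂ _+_ (+-split ab∈) eq))

deg-factorisation : ∀ m {a b} → (a , b) ∈ factorisations m → deg a + deg b ≡ deg m
deg-factorisation m ab∈ = splitEntries⁺
  (λ m (a , b) → ∀ w → degFrom w a + degFrom w b ≡ degFrom w m) (λ _ → refl)
  (λ {x} {xs} {a} {b} {as} {bs} ab∈ eq w →
    trans (+-CS.interchange (w ℕ.* sum a) (degFrom (suc w) as) (w ℕ.* sum b) (degFrom (suc w) bs))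
      (cong₂ _+_ (trans (sym (ℕ.*-distribˡ-+ w (sum a) (sum b))) (cong (w ℕ.*_) (sum-split x ab∈)))
                 (eq (suc w))))
  m ab∈ 1

-- The coefficients of the P d

-- The coefficient function `1ˢ` in product form, to which `convolve-Π` applies.
oneᵐ : Monomial → ℚ
oneᵐ = Π (Π isZero)

oneᵐ-yes : ∀ {m} → IsOne m → oneᵐ m ≡ 1ℚ
oneᵐ-yes m≡1 = Π-one (All.map (λ row≡0 → Π-one (All.map (λ { refl → refl }) row≡0)) m≡1)

oneᵐ-no : ∀ {m} → ¬ IsOne m → oneᵐ m ≡ 0ℚ
oneᵐ-no {m} m≢1 = trans (Π-cong m (Π-𝟙 (ℕ._≟ 0)))
  (trans (Π-𝟙 (all? (ℕ._≟ 0)) m) (𝟙-no (isOne? m) m≢1))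

rowOne-no : ∀ {row} → ¬ All (_≡ 0) row → Π isZero row ≡ 0ℚ
rowOne-no {row} row≢0 = trans (Π-𝟙 (ℕ._≟ 0) row) (𝟙-no (all? (ℕ._≟ 0) row) row≢0)

1ˢ≡oneᵐ : ∀ m → 1ˢ m ≡ oneᵐ m
1ˢ≡oneᵐ m = trans (𝟙-entries-unit (entries? 0 ℕ._≟_) refl m)
  (Π-cong m (𝟙-entries-unit ℕ._≟_ refl))

-- rowPower e is the indicator of the rows x_j^e, and rowPowers that of the rows
-- x_j^e with e ≥ 1. Likewise powers is i at x_{i,j}^e with e ≥ 1, and 0 elsewhere.
rowPower : ℕ → List ℕ → ℚ
rowPower e = leibniz isZero (λ _ x → 𝟙[ x ℕ.≟ e ]) 0

rowPowers : List ℕ → ℚ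
rowPowers = leibniz isZero (λ _ → isPos) 0

powers : Monomial → ℚ
powers = leibniz (Π isZero) (λ w row → fromℕ w ℚ.* rowPowers row) 1

powers-one : ∀ {m} → IsOne m → powers m ≡ 0ℚ
powers-one m≡1 = leibniz-zero
  (All.map (λ row≡0 w → trans
    (cong (fromℕ w ℚ.*_) (leibniz-zero (All.map (λ { refl _ → refl }) row≡0) 0))
    (ℚ.*-zeroʳ (fromℕ w))) m≡1) 1

-- Two nested uses of `convolve-leibniz`: over the rows, where the weight `w` is a scalar that can
-- be pulled out, and within one row over its exponents.
convolve-rowPowers : ∀ {h q : ℕ → ℚ} → (∀ x → convolve splitExponent h isZero x ≡ h x) →
  (∀ x → convolve splitExponent h isPos x ≡ q x) → ∀ m →
  convolve factorisations (Π (Π h)) powers m ≡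
  leibniz (Π h) (λ w row → fromℕ w ℚ.* leibniz h (λ _ → q) 0 row) 1 m
convolve-rowPowers {h} {q} unit entry = convolve-leibniz (convolve-Π unit) row-powers 1
  where
  row-powers : ∀ w row →
    convolve (splitEntries splitExponent) (Π h) (λ r → fromℕ w ℚ.* rowPowers r) row ≡
    fromℕ w ℚ.* leibniz h (λ _ → q) 0 row
  row-powers w row = begin
    ∑ ss (λ (a , b) → Π h a ℚ.* (fromℕ w ℚ.* rowPowers b))
      ≡⟨ ∑-cong ss (λ {(a , b)} _ → *-swap (Π h a) (fromℕ w) (rowPowers b)) ⟩
    ∑ ss (λ (a , b) → fromℕ w ℚ.* (Π h a ℚ.* rowPowers b))
      ≡⟨ *-∑ (fromℕ w) ss ⟨
    fromℕ w ℚ.* convolve (splitEntries splitExponent) (Π h) rowPowers row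
      ≡⟨ cong (fromℕ w ℚ.*_) (convolve-leibniz unit (λ _ → entry) 0 row) ⟩
    fromℕ w ℚ.* leibniz h (λ _ → q) 0 row ∎
    where ss = splitEntries splitExponent row

-- The indicator of one x_{i,j}^e is a `single` on rows whose inner function is a `single` on
-- exponents. The outer one is linear in the inner function, so the sum over `j` moves inside and
-- becomes a Leibniz sum. Positivity of `e` keeps the power distinct from a missing entry.
powerSum≡single : ∀ i {e} → 0 < e → ∀ m → powerSum i e m ≡ single (Π isZero) (rowPower e) i m
powerSum≡single i {e} e>0 m = begin
  powerSum i e m
    ≡⟨ ∑ℚ≡∑ (upTo (columns m)) _ ⟩
  ∑ (upTo (columns m)) (λ j → 𝟙[ m ≈ᵐ? xPower i j e ])
    ≡⟨ ∑-cong (upTo (columns m)) (λ {j} _ → 𝟙-entries-single (entries? 0 ℕ._≟_) refl (rowMatch j []) i m) ⟩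
  ∑ (upTo (columns m)) (λ j → single (λ row → 𝟙[ entries? 0 ℕ._≟_ row [] ])
                                     (λ row → 𝟙[ entries? 0 ℕ._≟_ row (replicate j 0 ++ [ e ]) ]) i m)
    ≡⟨ ∑-cong (upTo (columns m)) (λ {j} _ →
         single-cong (𝟙-entries-unit ℕ._≟_ refl) i m (λ {row} _ → rowMatch j row)) ⟩
  ∑ (upTo (columns m)) (λ j → single (Π isZero) (single isZero (λ x → 𝟙[ x ℕ.≟ e ]) j) i m)
    ≡⟨ ∑-single (upTo (columns m)) i m ⟩
  single (Π isZero) (λ row → ∑ (upTo (columns m)) (λ j → single isZero (λ x → 𝟙[ x ℕ.≟ e ]) j row)) i m
    ≡⟨ single-cong (λ _ → refl) i m (λ {row} row∈ → leibniz-∑ 0 row (columns m) (length≤columns row∈)) ⟩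
  single (Π isZero) (rowPower e) i m ∎
  where
  rowMatch : ∀ j row → 𝟙[ entries? 0 ℕ._≟_ row (replicate j 0 ++ [ e ]) ] ≡
                       single isZero (λ x → 𝟙[ x ℕ.≟ e ]) j row
  rowMatch = 𝟙-entries-single ℕ._≟_ refl (𝟙-no (0 ℕ.≟ e) (ℕ.<⇒≢ e>0))

-- A Leibniz term survives only if all other entries are 0, and then the remaining entry is the sum
-- of the row. So the test against `e` can be made on that sum, which is the same for every
-- position.
rowPower≡rowPowers : ∀ {e} → 0 < e → ∀ row → rowPower e row ≡ 𝟙[ sum row ℕ.≟ e ] ℚ.* rowPowers row
rowPower≡rowPowers {e} e>0 = from 0
  where
  from : ∀ w row → leibniz isZero (λ _ x → 𝟙[ x ℕ.≟ e ]) w row ≡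
                   𝟙[ sum row ℕ.≟ e ] ℚ.* leibniz isZero (λ _ → isPos) w row
  from w [] = sym (ℚ.*-zeroʳ 𝟙[ 0 ℕ.≟ e ])
  from w (zero ∷ row) = begin
    𝟙[ 0 ℕ.≟ e ] ℚ.* Π isZero row ℚ.+ 1ℚ ℚ.* leibniz isZero (λ _ x → 𝟙[ x ℕ.≟ e ]) (suc w) row
      ≡⟨ cong₂ (λ a b → a ℚ.* Π isZero row ℚ.+ 1ℚ ℚ.* b) (𝟙-no (0 ℕ.≟ e) (ℕ.<⇒≢ e>0)) (from (suc w) row) ⟩
    0ℚ ℚ.* Π isZero row ℚ.+ 1ℚ ℚ.* (𝟙[ sum row ℕ.≟ e ] ℚ.* leibniz isZero (λ _ → isPos) (suc w) row)
      ≡⟨ solve 3 (λ z s r → con 0ℚ :* z :+ con 1ℚ :* (s :* r) := s :* (con 0ℚ :* z :+ con 1ℚ :* r)) refl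
           (Π isZero row) 𝟙[ sum row ℕ.≟ e ] (leibniz isZero (λ _ → isPos) (suc w) row) ⟩
    𝟙[ sum row ℕ.≟ e ] ℚ.* (0ℚ ℚ.* Π isZero row ℚ.+ 1ℚ ℚ.* leibniz isZero (λ _ → isPos) (suc w) row) ∎
  from w (suc x ∷ row) = begin
    𝟙[ suc x ℕ.≟ e ] ℚ.* Π isZero row ℚ.+ 0ℚ ℚ.* leibniz isZero (λ _ x → 𝟙[ x ℕ.≟ e ]) (suc w) row
      ≡⟨ cong (𝟙[ suc x ℕ.≟ e ] ℚ.* Π isZero row ℚ.+_)
           (trans (ℚ.*-zeroˡ (leibniz isZero (λ _ x → 𝟙[ x ℕ.≟ e ]) (suc w) row))
                  (sym (ℚ.*-zeroˡ (leibniz isZero (λ _ → isPos) (suc w) row)))) ⟩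
    𝟙[ suc x ℕ.≟ e ] ℚ.* Π isZero row ℚ.+ 0ℚ ℚ.* leibniz isZero (λ _ → isPos) (suc w) row
      ≡⟨ cong (ℚ._+ 0ℚ ℚ.* leibniz isZero (λ _ → isPos) (suc w) row) rest-zero ⟩
    𝟙[ suc x + sum row ℕ.≟ e ] ℚ.* Π isZero row ℚ.+ 0ℚ ℚ.* leibniz isZero (λ _ → isPos) (suc w) row
      ≡⟨ solve 3 (λ z s r → s :* z :+ con 0ℚ :* r := s :* (con 1ℚ :* z :+ con 0ℚ :* r)) refl
           (Π isZero row) 𝟙[ suc x + sum row ℕ.≟ e ] (leibniz isZero (λ _ → isPos) (suc w) row) ⟩
    𝟙[ suc x + sum row ℕ.≟ e ] ℚ.* (1ℚ ℚ.* Π isZero row ℚ.+ 0ℚ ℚ.* leibniz isZero (λ _ → isPos) (suc w) row) ∎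
    where
    rest-zero : 𝟙[ suc x ℕ.≟ e ] ℚ.* Π isZero row ≡ 𝟙[ suc x + sum row ℕ.≟ e ] ℚ.* Π isZero row
    rest-zero with all? (ℕ._≟ 0) row
    ... | yes row≡0 = cong (λ k → 𝟙[ k ℕ.≟ e ] ℚ.* Π isZero row)
                        (sym (trans (cong (suc x +_) (sum-zero row≡0)) (ℕ.+-identityʳ (suc x))))
    ... | no  row≢0 = trans (zero* 𝟙[ suc x ℕ.≟ e ]) (sym (zero* 𝟙[ suc x + sum row ℕ.≟ e ]))
      where
      zero* : ∀ c → c ℚ.* Π isZero row ≡ 0ℚ
      zero* c = trans (cong (c ℚ.*_) (rowOne-no row≢0)) (ℚ.*-zeroʳ c)

-- If v divides n, having sum n / v means that v times the sum is n. If not, no multiple of v equals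
-- n and both sides vanish. The rounded quotient thus never matters.
rowPower-∣ : ∀ {n} → 0 < n → ∀ v .⦃ _ : NonZero v ⦄ row →
  𝟙[ v ∣? n ] ℚ.* rowPower (n / v) row ≡ 𝟙[ v ℕ.* sum row ℕ.≟ n ] ℚ.* rowPowers row
rowPower-∣ {n} n>0 v row = by-cases (v ∣? n)
  where
  e = n / v
  by-cases : (v∣?n : Dec (v ∣ n)) →
    𝟙[ v∣?n ] ℚ.* rowPower e row ≡ 𝟙[ v ℕ.* sum row ℕ.≟ n ] ℚ.* rowPowers row
  by-cases (yes v∣n) = begin
    1ℚ ℚ.* rowPower e row
      ≡⟨ ℚ.*-identityˡ (rowPower e row) ⟩
    rowPower e row
      ≡⟨ rowPower≡rowPowers e>0 row ⟩
    𝟙[ sum row ℕ.≟ e ] ℚ.* rowPowers row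
      ≡⟨ cong (ℚ._* rowPowers row) (𝟙-cong (sum row ℕ.≟ e) (v ℕ.* sum row ℕ.≟ n)
           (λ eq → trans (cong (v ℕ.*_) eq) ve≡n)
           (λ eq → ℕ.*-cancelˡ-≡ (sum row) e v (trans eq (sym ve≡n)))) ⟩
    𝟙[ v ℕ.* sum row ℕ.≟ n ] ℚ.* rowPowers row ∎
    where
    ve≡n : v ℕ.* e ≡ n
    ve≡n = m*[n/m]≡n v∣n
    e>0 : 0 < e
    e>0 = ℕ.n≢0⇒n>0 (λ e≡0 → ℕ.<⇒≢ n>0 (trans (sym (trans (cong (v ℕ.*_) e≡0) (ℕ.*-zeroʳ v))) ve≡n))
  by-cases (no v∤n) = begin
    0ℚ ℚ.* rowPower e row
      ≡⟨ ℚ.*-zeroˡ (rowPower e row) ⟩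
    0ℚ
      ≡⟨ ℚ.*-zeroˡ (rowPowers row) ⟨
    0ℚ ℚ.* rowPowers row
      ≡⟨ cong (ℚ._* rowPowers row)
           (𝟙-no (v ℕ.* sum row ℕ.≟ n) (λ eq → v∤n (subst (v ∣_) eq (m∣m*n (sum row))))) ⟨
    𝟙[ v ℕ.* sum row ℕ.≟ n ] ℚ.* rowPowers row ∎

-- Where `single` is nonzero, all rows but row `i` vanish, so the degree is the weight w + i of that
-- row times its sum. The weight is a separate argument `v` so that `n / v` stays fixed while `w`
-- and `i` change in the induction.
single-∣ : ∀ {n} → 0 < n → ∀ v .⦃ _ : NonZero v ⦄ i w → w + i ≡ v → ∀ m →
  𝟙[ v ∣? n ] ℚ.* single (Π isZero) (rowPower (n / v)) i m ≡
  𝟙[ degFrom w m ℕ.≟ n ] ℚ.* single (Π isZero) rowPowers i m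
single-∣ {n} n>0 v i w w+i≡v [] = trans (ℚ.*-zeroʳ 𝟙[ v ∣? n ]) (sym (ℚ.*-zeroʳ 𝟙[ 0 ℕ.≟ n ]))
single-∣ {n} n>0 v zero w w+0≡v (row ∷ m) with isOne? m
... | yes m≡1 = begin
  𝟙[ v ∣? n ] ℚ.* (rowPower (n / v) row ℚ.* oneᵐ m)
    ≡⟨ ℚ.*-assoc 𝟙[ v ∣? n ] (rowPower (n / v) row) (oneᵐ m) ⟨
  𝟙[ v ∣? n ] ℚ.* rowPower (n / v) row ℚ.* oneᵐ m
    ≡⟨ cong (ℚ._* oneᵐ m) (rowPower-∣ n>0 v row) ⟩
  𝟙[ v ℕ.* sum row ℕ.≟ n ] ℚ.* rowPowers row ℚ.* oneᵐ m
    ≡⟨ cong (λ k → 𝟙[ k ℕ.≟ n ] ℚ.* rowPowers row ℚ.* oneᵐ m) degree ⟩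
  𝟙[ degFrom w (row ∷ m) ℕ.≟ n ] ℚ.* rowPowers row ℚ.* oneᵐ m
    ≡⟨ ℚ.*-assoc 𝟙[ degFrom w (row ∷ m) ℕ.≟ n ] (rowPowers row) (oneᵐ m) ⟩
  𝟙[ degFrom w (row ∷ m) ℕ.≟ n ] ℚ.* (rowPowers row ℚ.* oneᵐ m) ∎
  where
  degree : v ℕ.* sum row ≡ degFrom w (row ∷ m)
  degree = sym (trans (cong (w ℕ.* sum row +_) (degFrom-one (suc w) m≡1))
    (trans (ℕ.+-identityʳ (w ℕ.* sum row)) (cong (ℕ._* sum row) (trans (sym (ℕ.+-identityʳ w)) w+0≡v))))
... | no m≢1 = trans (zero* 𝟙[ v ∣? n ] (rowPower (n / v) row))
                     (sym (zero* 𝟙[ degFrom w (row ∷ m) ℕ.≟ n ] (rowPowers row)))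
  where
  zero* : ∀ c d → c ℚ.* (d ℚ.* oneᵐ m) ≡ 0ℚ
  zero* c d = trans (cong (λ z → c ℚ.* (d ℚ.* z)) (oneᵐ-no m≢1))
    (trans (cong (c ℚ.*_) (ℚ.*-zeroʳ d)) (ℚ.*-zeroʳ c))
single-∣ {n} n>0 v (suc i) w w+i≡v (row ∷ m) with all? (ℕ._≟ 0) row
... | yes row≡0 = begin
  𝟙[ v ∣? n ] ℚ.* (Π isZero row ℚ.* s)
    ≡⟨ *-swap 𝟙[ v ∣? n ] (Π isZero row) s ⟩
  Π isZero row ℚ.* (𝟙[ v ∣? n ] ℚ.* s)
    ≡⟨ cong (Π isZero row ℚ.*_) (single-∣ n>0 v i (suc w) (trans (sym (ℕ.+-suc w i)) w+i≡v) m) ⟩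
  Π isZero row ℚ.* (𝟙[ degFrom (suc w) m ℕ.≟ n ] ℚ.* t)
    ≡⟨ *-swap (Π isZero row) 𝟙[ degFrom (suc w) m ℕ.≟ n ] t ⟩
  𝟙[ degFrom (suc w) m ℕ.≟ n ] ℚ.* (Π isZero row ℚ.* t)
    ≡⟨ cong (λ k → 𝟙[ k ℕ.≟ n ] ℚ.* (Π isZero row ℚ.* t)) degree ⟩
  𝟙[ degFrom w (row ∷ m) ℕ.≟ n ] ℚ.* (Π isZero row ℚ.* t) ∎
  where
  s = single (Π isZero) (rowPower (n / v)) i m
  t = single (Π isZero) rowPowers i m
  degree : degFrom (suc w) m ≡ degFrom w (row ∷ m)
  degree = sym (cong (_+ degFrom (suc w) m) (trans (cong (w ℕ.*_) (sum-zero row≡0)) (ℕ.*-zeroʳ w)))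
... | no row≢0 = trans (zero* 𝟙[ v ∣? n ] (single (Π isZero) (rowPower (n / v)) i m))
                       (sym (zero* 𝟙[ degFrom w (row ∷ m) ℕ.≟ n ] (single (Π isZero) rowPowers i m)))
  where
  zero* : ∀ c d → c ℚ.* (Π isZero row ℚ.* d) ≡ 0ℚ
  zero* c d = trans (cong (λ z → c ℚ.* (z ℚ.* d)) (rowOne-no row≢0))
    (trans (cong (c ℚ.*_) (ℚ.*-zeroˡ d)) (ℚ.*-zeroʳ c))

-- The divisor and the quotient that `n` imposes on each row merge into one degree test, so `powers`
-- itself does not depend on `n`.
P≡powers : ∀ {n} → 0 < n → ∀ m → P n m ≡ 𝟙[ deg m ℕ.≟ n ] ℚ.* powers m
P≡powers {n} n>0 m = begin
  P n m
    ≡⟨ ∑ℚ≡∑ (predDivisors n) _ ⟩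
  ∑ (predDivisors n) (λ i → fromℕ (suc i) ℚ.* powerSum i (n / suc i) m)
    ≡⟨ ∑-cong (predDivisors n) (λ {i} i∈ →
         cong (fromℕ (suc i) ℚ.*_) (powerSum≡single i (quotient>0 i∈) m)) ⟩
  ∑ (predDivisors n) (λ i → fromℕ (suc i) ℚ.* S i)
    ≡⟨ ∑-filter (λ i → suc i ∣? n) (upTo n) ⟩
  ∑ (upTo n) (λ i → 𝟙[ suc i ∣? n ] ℚ.* (fromℕ (suc i) ℚ.* S i))
    -- The range is lengthened to reach every row of `m`; the added indices give candidates larger
    -- than `n`, which cannot divide it.
    ≡⟨ ∑-upTo-+ n (length m) (λ i → trans
         (cong (ℚ._* (fromℕ (suc (n + i)) ℚ.* S (n + i)))
           (𝟙-no (suc (n + i) ∣? n) (>⇒∤ ⦃ >-nonZero n>0 ⦄ (s≤s (ℕ.m≤m+n n i)))))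
         (ℚ.*-zeroˡ (fromℕ (suc (n + i)) ℚ.* S (n + i)))) ⟨
  ∑ (upTo (n + length m)) (λ i → 𝟙[ suc i ∣? n ] ℚ.* (fromℕ (suc i) ℚ.* S i))
    ≡⟨ ∑-cong (upTo (n + length m)) (λ {i} _ → term i) ⟩
  ∑ (upTo (n + length m)) (λ i → 𝟙[ deg m ℕ.≟ n ] ℚ.* U i)
    ≡⟨ *-∑ 𝟙[ deg m ℕ.≟ n ] (upTo (n + length m)) ⟨
  𝟙[ deg m ℕ.≟ n ] ℚ.* ∑ (upTo (n + length m)) U
    ≡⟨ cong (𝟙[ deg m ℕ.≟ n ] ℚ.*_) (leibniz-∑ 1 m (n + length m) (ℕ.m≤n+m (length m) n)) ⟩
  𝟙[ deg m ℕ.≟ n ] ℚ.* powers m ∎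
  where
  S U : ℕ → ℚ
  S i = single (Π isZero) (rowPower (n / suc i)) i m
  U i = single (Π isZero) (λ row → fromℕ (suc i) ℚ.* rowPowers row) i m
  quotient>0 : ∀ {i} → i ∈ predDivisors n → 0 < n / suc i
  quotient>0 {i} i∈ = m≥n⇒m/n>0 (∣⇒≤ ⦃ >-nonZero n>0 ⦄ (proj₂ (∈-filter⁻ (λ i → suc i ∣? n) {xs = upTo n} i∈)))
  term : ∀ i → 𝟙[ suc i ∣? n ] ℚ.* (fromℕ (suc i) ℚ.* S i) ≡ 𝟙[ deg m ℕ.≟ n ] ℚ.* U i
  term i = begin
    𝟙[ suc i ∣? n ] ℚ.* (fromℕ (suc i) ℚ.* S i)
      ≡⟨ *-swap 𝟙[ suc i ∣? n ] (fromℕ (suc i)) (S i) ⟩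
    fromℕ (suc i) ℚ.* (𝟙[ suc i ∣? n ] ℚ.* S i)
      ≡⟨ cong (fromℕ (suc i) ℚ.*_) (single-∣ n>0 (suc i) i 1 refl m) ⟩
    fromℕ (suc i) ℚ.* (𝟙[ deg m ℕ.≟ n ] ℚ.* single (Π isZero) rowPowers i m)
      ≡⟨ *-swap (fromℕ (suc i)) 𝟙[ deg m ℕ.≟ n ] (single (Π isZero) rowPowers i m) ⟩
    𝟙[ deg m ℕ.≟ n ] ℚ.* (fromℕ (suc i) ℚ.* single (Π isZero) rowPowers i m)
      ≡⟨ cong (𝟙[ deg m ℕ.≟ n ] ℚ.*_) (*-single (fromℕ (suc i)) i m) ⟩
    𝟙[ deg m ℕ.≟ n ] ℚ.* U i ∎

-- Newton’s identities

⟨1⟩ : ∀ f m → (f ⟨ 1 ⟩) m ≡ f m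
⟨1⟩ f m = begin
  (if does (all? (all? (1 ∣?_)) m) then f (map (map (_/ 1)) m) else 0ℚ)
    ≡⟨ cong (if_then f (map (map (_/ 1)) m) else 0ℚ)
         (dec-true (all? (all? (1 ∣?_)) m) (All.universal (All.universal 1∣_) m)) ⟩
  f (map (map (_/ 1)) m)
    ≡⟨ cong f (map-id-local (All.universal (λ row → map-id-local (All.universal n/1≡n row)) m)) ⟩
  f m ∎

*ˢ≡convolve : ∀ f g m → (f *ˢ g) m ≡ convolve factorisations f g m
*ˢ≡convolve f g m = ∑ℚ≡∑ (factorisations m) _

nonempty : ∀ {n α} → α ∈ compositionsFrom 1 n → ¬ α ≡ []
nonempty {n} α∈ refl with _ , () ← Equivalence.to (∈-compositions {suc n}) α∈

-- `h` is the factor that one exponent contributes to a coefficient of `F d`, and `c` is the signed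
-- coefficient of F_α in the theorem: prepending a part flips the sign and keeps the last part.
module _ (F : ℕ → Series) (h : ℕ → ℚ) (s : ℚ) (c : Composition → ℚ)
  (h-zero : h 0 ≡ 1ℚ)
  (h-isPos : ∀ x → convolve splitExponent h isPos x ≡ s ℚ.* fromℕ x ℚ.* h x)
  (F≡ : ∀ d m → F d m ≡ 𝟙[ deg m ℕ.≟ d ] ℚ.* Π (Π h) m)
  (c-[] : ∀ a → c [ a ] ≡ s ℚ.* fromℕ a)
  (c-∷ : ∀ a b β → c (a ∷ b ∷ β) ≡ ℚ.- c (b ∷ β))
  where

  hᵐ : Monomial → ℚ
  hᵐ = Π (Π h)

  convolve-powers : ∀ m → convolve factorisations hᵐ powers m ≡ s ℚ.* fromℕ (deg m) ℚ.* hᵐ m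
  convolve-powers m = begin
    convolve factorisations hᵐ powers m
      ≡⟨ convolve-rowPowers (convolve-isZeroʳ h) h-isPos m ⟩
    leibniz (Π h) (λ w row → fromℕ w ℚ.* leibniz h (λ _ x → s ℚ.* fromℕ x ℚ.* h x) 0 row) 1 m
      ≡⟨ leibniz-cong row-degree 1 m ⟩
    leibniz (Π h) (λ w row → s ℚ.* fromℕ (w ℕ.* sum row) ℚ.* Π h row) 1 m
      ≡⟨ leibniz-degree s (λ w row → w ℕ.* sum row) degFrom (λ _ → refl) (λ _ _ _ → refl) 1 m ⟩
    s ℚ.* fromℕ (deg m) ℚ.* hᵐ m ∎
    where
    row-degree : ∀ w row → fromℕ w ℚ.* leibniz h (λ _ x → s ℚ.* fromℕ x ℚ.* h x) 0 row ≡
                           s ℚ.* fromℕ (w ℕ.* sum row) ℚ.* Π h row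
    row-degree w row = begin
      fromℕ w ℚ.* leibniz h (λ _ x → s ℚ.* fromℕ x ℚ.* h x) 0 row
        ≡⟨ cong (fromℕ w ℚ.*_)
             (leibniz-degree s (λ _ x → x) (λ _ → sum) (λ _ → refl) (λ _ _ _ → refl) 0 row) ⟩
      fromℕ w ℚ.* (s ℚ.* fromℕ (sum row) ℚ.* Π h row)
        ≡⟨ solve 4 (λ w s d h → w :* (s :* d :* h) := s :* (w :* d) :* h) refl
             (fromℕ w) s (fromℕ (sum row)) (Π h row) ⟩
      s ℚ.* (fromℕ w ℚ.* fromℕ (sum row)) ℚ.* Π h row
        ≡⟨ cong (λ d → s ℚ.* d ℚ.* Π h row) (fromℕ-* w (sum row)) ⟨
      s ℚ.* fromℕ (w ℕ.* sum row) ℚ.* Π h row ∎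

  -- The product over the blocks of a one-part composition ends in `1ˢ`. Only factorisations with
  -- second factor 1 contribute, so the degree test can be moved from the first factor to `m` and
  -- out of the sum.
  F-*-1 : ∀ d m → convolve factorisations (F d) 1ˢ m ≡ F d m
  F-*-1 d m = begin
    convolve factorisations (F d) 1ˢ m
      ≡⟨ ∑-cong (factorisations m) (λ {(a , b)} ab∈ → term a b (deg-factorisation m ab∈)) ⟩
    ∑ (factorisations m) (λ (a , b) → 𝟙[ deg m ℕ.≟ d ] ℚ.* (hᵐ a ℚ.* oneᵐ b))
      ≡⟨ *-∑ 𝟙[ deg m ℕ.≟ d ] (factorisations m) ⟨
    𝟙[ deg m ℕ.≟ d ] ℚ.* convolve factorisations hᵐ oneᵐ m
      ≡⟨ cong (𝟙[ deg m ℕ.≟ d ] ℚ.*_) (convolve-Π (convolve-Π (convolve-isZeroʳ h)) m) ⟩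
    𝟙[ deg m ℕ.≟ d ] ℚ.* hᵐ m
      ≡⟨ F≡ d m ⟨
    F d m ∎
    where
    term : ∀ a b → deg a + deg b ≡ deg m →
           F d a ℚ.* 1ˢ b ≡ 𝟙[ deg m ℕ.≟ d ] ℚ.* (hᵐ a ℚ.* oneᵐ b)
    term a b eq = trans (cong₂ ℚ._*_ (F≡ d a) (1ˢ≡oneᵐ b)) (by-cases (isOne? b))
      where
      by-cases : Dec (IsOne b) →
                 𝟙[ deg a ℕ.≟ d ] ℚ.* hᵐ a ℚ.* oneᵐ b ≡ 𝟙[ deg m ℕ.≟ d ] ℚ.* (hᵐ a ℚ.* oneᵐ b)
      by-cases (yes b≡1) = trans (ℚ.*-assoc 𝟙[ deg a ℕ.≟ d ] (hᵐ a) (oneᵐ b))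
        (cong (λ k → 𝟙[ k ℕ.≟ d ] ℚ.* (hᵐ a ℚ.* oneᵐ b))
          (trans (sym (ℕ.+-identityʳ (deg a))) (trans (cong (deg a +_) (sym (degFrom-one 1 b≡1))) eq)))
      by-cases (no b≢1) rewrite oneᵐ-no b≢1 =
        solve 3 (λ x y z → x :* y :* con 0ℚ := z :* (y :* con 0ℚ)) refl
          𝟙[ deg a ℕ.≟ d ] (hᵐ a) 𝟙[ deg m ℕ.≟ d ]

  F0≡oneᵐ : ∀ m → F 0 m ≡ oneᵐ m
  F0≡oneᵐ m = trans (F≡ 0 m) (by-cases (isOne? m))
    where
    by-cases : Dec (IsOne m) → 𝟙[ deg m ℕ.≟ 0 ] ℚ.* hᵐ m ≡ oneᵐ m
    by-cases (yes m≡1) = trans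
      (cong₂ ℚ._*_ (𝟙-yes (deg m ℕ.≟ 0) (degFrom-one 1 m≡1))
        (Π-one (All.map (λ row≡0 → Π-one (All.map (λ { refl → h-zero }) row≡0)) m≡1)))
      (sym (oneᵐ-yes m≡1))
    by-cases (no m≢1) = trans
      (cong (ℚ._* hᵐ m) (𝟙-no (deg m ℕ.≟ 0) (m≢1 ∘ one-degFrom 0 m)))
      (trans (ℚ.*-zeroˡ (hᵐ m)) (sym (oneᵐ-no m≢1)))

  F0-*-P : ∀ n m → convolve factorisations (F 0) (P (suc n)) m ≡ P (suc n) m
  F0-*-P n m = begin
    convolve factorisations (F 0) (P (suc n)) m
      ≡⟨ ∑-cong (factorisations m) (λ {(a , b)} ab∈ → term a b (deg-factorisation m ab∈)) ⟩
    ∑ (factorisations m) (λ (a , b) → 𝟙[ deg m ℕ.≟ suc n ] ℚ.* (oneᵐ a ℚ.* powers b))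
      ≡⟨ *-∑ 𝟙[ deg m ℕ.≟ suc n ] (factorisations m) ⟨
    𝟙[ deg m ℕ.≟ suc n ] ℚ.* convolve factorisations oneᵐ powers m
      ≡⟨ cong (𝟙[ deg m ℕ.≟ suc n ] ℚ.*_)
           (convolve-rowPowers (convolve-isZeroˡ isZero) (convolve-isZeroˡ isPos) m) ⟩
    𝟙[ deg m ℕ.≟ suc n ] ℚ.* powers m
      ≡⟨ P≡powers z<s m ⟨
    P (suc n) m ∎
    where
    term : ∀ a b → deg a + deg b ≡ deg m →
           F 0 a ℚ.* P (suc n) b ≡ 𝟙[ deg m ℕ.≟ suc n ] ℚ.* (oneᵐ a ℚ.* powers b)
    term a b eq = trans (cong₂ ℚ._*_ (F0≡oneᵐ a) (P≡powers z<s b)) (by-cases (isOne? a))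
      where
      by-cases : Dec (IsOne a) → oneᵐ a ℚ.* (𝟙[ deg b ℕ.≟ suc n ] ℚ.* powers b) ≡
                                 𝟙[ deg m ℕ.≟ suc n ] ℚ.* (oneᵐ a ℚ.* powers b)
      by-cases (yes a≡1) = trans (*-swap (oneᵐ a) 𝟙[ deg b ℕ.≟ suc n ] (powers b))
        (cong (λ k → 𝟙[ k ℕ.≟ suc n ] ℚ.* (oneᵐ a ℚ.* powers b))
          (trans (cong (_+ deg b) (sym (degFrom-one 1 a≡1))) eq))
      by-cases (no a≢1) rewrite oneᵐ-no a≢1 =
        solve 3 (λ x y z → con 0ℚ :* (x :* y) := z :* (con 0ℚ :* y)) refl
          𝟙[ deg b ℕ.≟ suc n ] (powers b) 𝟙[ deg m ℕ.≟ suc n ]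

  -- F a * P n + F (a + 1) * P (n - 1) + ⋯ + F (a + n - 1) * P 1
  tail : ℕ → ℕ → Series
  tail a zero    m = 0ℚ
  tail a (suc n) m = convolve factorisations (F a) (P (suc n)) m ℚ.+ tail (suc a) n m

  tailTerm : ℕ → ℕ → Monomial → Monomial → ℚ
  tailTerm a zero    x y = 0ℚ
  tailTerm a (suc n) x y = F a x ℚ.* P (suc n) y ℚ.+ tailTerm (suc a) n x y

  tail≡∑ : ∀ a n m → tail a n m ≡ ∑ (factorisations m) (λ (x , y) → tailTerm a n x y)
  tail≡∑ a zero    m = sym (∑-0 (factorisations m))
  tail≡∑ a (suc n) m =
    trans (cong (convolve factorisations (F a) (P (suc n)) m ℚ.+_) (tail≡∑ (suc a) n m))
          (sym (∑-+ (factorisations m)))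

  F-≢ : ∀ {a x} → ¬ deg x ≡ a → F a x ≡ 0ℚ
  F-≢ {a} {x} x≢a =
    trans (F≡ a x) (trans (cong (ℚ._* hᵐ x) (𝟙-no (deg x ℕ.≟ a) x≢a)) (ℚ.*-zeroˡ (hᵐ x)))

  tailTerm-< : ∀ a n x y → deg x < a → tailTerm a n x y ≡ 0ℚ
  tailTerm-< a zero    x y x<a = refl
  tailTerm-< a (suc n) x y x<a =
    cong₂ ℚ._+_ (trans (cong (ℚ._* P (suc n) y) (F-≢ (ℕ.<⇒≢ x<a))) (ℚ.*-zeroˡ (P (suc n) y)))
                (tailTerm-< (suc a) n x y (ℕ.m<n⇒m<1+n x<a))

  -- For a fixed factorisation only the summand with `F` of index deg x can survive. If it is in
  -- range, the index of its `P` equals deg y exactly when the degrees add up to a + n.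
  tailTerm-≥ : ∀ a n x y → a ≤ deg x →
               tailTerm a n x y ≡ 𝟙[ deg x + deg y ℕ.≟ a + n ] ℚ.* (hᵐ x ℚ.* powers y)
  -- The range is exhausted. The degrees could still add up to `a`, but only with deg y = 0, and
  -- `powers` vanishes at 1.
  tailTerm-≥ a zero x y a≤x = sym (by-cases (isOne? y))
    where
    by-cases : Dec (IsOne y) → 𝟙[ deg x + deg y ℕ.≟ a + 0 ] ℚ.* (hᵐ x ℚ.* powers y) ≡ 0ℚ
    by-cases (yes y≡1) = trans
      (cong (𝟙[ deg x + deg y ℕ.≟ a + 0 ] ℚ.*_)
        (trans (cong (hᵐ x ℚ.*_) (powers-one y≡1)) (ℚ.*-zeroʳ (hᵐ x))))
      (ℚ.*-zeroʳ 𝟙[ deg x + deg y ℕ.≟ a + 0 ])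
    by-cases (no y≢1) = trans
      (cong (ℚ._* (hᵐ x ℚ.* powers y)) (𝟙-no (deg x + deg y ℕ.≟ a + 0)
        (λ eq → ℕ.<⇒≢ (ℕ.+-mono-≤-< a≤x (ℕ.n≢0⇒n>0 (y≢1 ∘ one-degFrom 0 y))) (sym eq))))
      (ℚ.*-zeroˡ (hᵐ x ℚ.* powers y))
  tailTerm-≥ a (suc n) x y a≤x with ℕ.m≤n⇒m<n∨m≡n a≤x
  ... | inj₁ a<x = begin
    F a x ℚ.* P (suc n) y ℚ.+ tailTerm (suc a) n x y
      ≡⟨ cong₂ ℚ._+_ (trans (cong (ℚ._* P (suc n) y) (F-≢ (ℕ.>⇒≢ a<x))) (ℚ.*-zeroˡ (P (suc n) y)))
                     (tailTerm-≥ (suc a) n x y a<x) ⟩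
    0ℚ ℚ.+ 𝟙[ deg x + deg y ℕ.≟ suc a + n ] ℚ.* (hᵐ x ℚ.* powers y)
      ≡⟨ ℚ.+-identityˡ (𝟙[ deg x + deg y ℕ.≟ suc a + n ] ℚ.* (hᵐ x ℚ.* powers y)) ⟩
    𝟙[ deg x + deg y ℕ.≟ suc a + n ] ℚ.* (hᵐ x ℚ.* powers y)
      ≡⟨ cong (λ k → 𝟙[ deg x + deg y ℕ.≟ k ] ℚ.* (hᵐ x ℚ.* powers y)) (ℕ.+-suc a n) ⟨
    𝟙[ deg x + deg y ℕ.≟ a + suc n ] ℚ.* (hᵐ x ℚ.* powers y) ∎
  ... | inj₂ a≡x = begin
    F a x ℚ.* P (suc n) y ℚ.+ tailTerm (suc a) n x y
      ≡⟨ cong₂ ℚ._+_ (cong₂ ℚ._*_ (F≡ a x) (P≡powers z<s y))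
                     (tailTerm-< (suc a) n x y (s≤s (ℕ.≤-reflexive (sym a≡x)))) ⟩
    𝟙[ deg x ℕ.≟ a ] ℚ.* hᵐ x ℚ.* (𝟙[ deg y ℕ.≟ suc n ] ℚ.* powers y) ℚ.+ 0ℚ
      ≡⟨ cong (λ i → i ℚ.* hᵐ x ℚ.* (𝟙[ deg y ℕ.≟ suc n ] ℚ.* powers y) ℚ.+ 0ℚ)
           (𝟙-yes (deg x ℕ.≟ a) (sym a≡x)) ⟩
    1ℚ ℚ.* hᵐ x ℚ.* (𝟙[ deg y ℕ.≟ suc n ] ℚ.* powers y) ℚ.+ 0ℚ
      ≡⟨ solve 3 (λ h i p → con 1ℚ :* h :* (i :* p) :+ con 0ℚ := i :* (h :* p)) refl
           (hᵐ x) 𝟙[ deg y ℕ.≟ suc n ] (powers y) ⟩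
    𝟙[ deg y ℕ.≟ suc n ] ℚ.* (hᵐ x ℚ.* powers y)
      ≡⟨ cong (ℚ._* (hᵐ x ℚ.* powers y)) (𝟙-cong (deg y ℕ.≟ suc n) (deg x + deg y ℕ.≟ a + suc n)
           (λ eq → cong₂ _+_ (sym a≡x) eq)
           (λ eq → ℕ.+-cancelˡ-≡ a (deg y) (suc n) (trans (cong (_+ deg y) a≡x) eq))) ⟩
    𝟙[ deg x + deg y ℕ.≟ a + suc n ] ℚ.* (hᵐ x ℚ.* powers y) ∎

  -- Newton's identity. With lower index 0 every factorisation satisfies the bound of `tailTerm-≥`,
  -- and the degree test becomes one on `m`.
  tail-0 : ∀ n m → tail 0 n m ≡ s ℚ.* fromℕ n ℚ.* F n m
  tail-0 n m = begin
    tail 0 n m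
      ≡⟨ tail≡∑ 0 n m ⟩
    ∑ (factorisations m) (λ (x , y) → tailTerm 0 n x y)
      ≡⟨ ∑-cong (factorisations m) (λ {(x , y)} xy∈ → trans (tailTerm-≥ 0 n x y z≤n)
           (cong (λ k → 𝟙[ k ℕ.≟ n ] ℚ.* (hᵐ x ℚ.* powers y)) (deg-factorisation m xy∈))) ⟩
    ∑ (factorisations m) (λ (x , y) → 𝟙[ deg m ℕ.≟ n ] ℚ.* (hᵐ x ℚ.* powers y))
      ≡⟨ *-∑ 𝟙[ deg m ℕ.≟ n ] (factorisations m) ⟨
    𝟙[ deg m ℕ.≟ n ] ℚ.* convolve factorisations hᵐ powers m
      ≡⟨ cong (𝟙[ deg m ℕ.≟ n ] ℚ.*_) (convolve-powers m) ⟩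
    𝟙[ deg m ℕ.≟ n ] ℚ.* (s ℚ.* fromℕ (deg m) ℚ.* hᵐ m)
      ≡⟨ by-cases (deg m ℕ.≟ n) ⟩
    s ℚ.* fromℕ n ℚ.* (𝟙[ deg m ℕ.≟ n ] ℚ.* hᵐ m)
      ≡⟨ cong (s ℚ.* fromℕ n ℚ.*_) (F≡ n m) ⟨
    s ℚ.* fromℕ n ℚ.* F n m ∎
    where
    by-cases : (eq? : Dec (deg m ≡ n)) →
      𝟙[ eq? ] ℚ.* (s ℚ.* fromℕ (deg m) ℚ.* hᵐ m) ≡ s ℚ.* fromℕ n ℚ.* (𝟙[ eq? ] ℚ.* hᵐ m)
    by-cases (yes eq) = trans (*-swap 1ℚ (s ℚ.* fromℕ (deg m)) (hᵐ m))
      (cong (λ k → s ℚ.* fromℕ k ℚ.* (1ℚ ℚ.* hᵐ m)) eq)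
    by-cases (no _) = solve 3 (λ a b h → con 0ℚ :* (a :* h) := b :* (con 0ℚ :* h)) refl
      (s ℚ.* fromℕ (deg m)) (s ℚ.* fromℕ n) (hᵐ m)

  -- Sums over compositions by their first part

  compositionSum : ℕ → ℕ → Series
  compositionSum a n m = ∑ (compositionsFrom a n) (λ α → c α ℚ.* (F ⟪ [ α ] ⟫) m)

  F-∷ : ∀ a β m → (F ⟪ [ a ∷ β ] ⟫) m ≡ convolve factorisations (F a) (F ⟪ [ β ] ⟫) m
  F-∷ a β m = trans (*ˢ≡convolve (F a ⟨ 1 ⟩) (F ⟪ [ β ] ⟫) m)
    (∑-cong (factorisations m) (λ {(x , y)} _ → cong (ℚ._* (F ⟪ [ β ] ⟫) y) (⟨1⟩ (F a) x)))

  -- If the first part is exactly `a`, removing it leaves a nonempty composition of n + 1 and costs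
  -- a factor `F a` and a sign. Otherwise the first part is at least a + 1.
  compositionSum-suc : ∀ a n m → compositionSum a (suc n) m ≡
    ℚ.- convolve factorisations (F a) (compositionSum 1 n) m ℚ.+ compositionSum (suc a) n m
  compositionSum-suc a n m = begin
    compositionSum a (suc n) m
      ≡⟨ ∑-++ (map (a ∷_) βs) (compositionsFrom (suc a) n) ⟩
    ∑ (map (a ∷_) βs) (λ α → c α ℚ.* (F ⟪ [ α ] ⟫) m) ℚ.+ compositionSum (suc a) n m
      ≡⟨ cong (ℚ._+ compositionSum (suc a) n m) (begin
           ∑ (map (a ∷_) βs) (λ α → c α ℚ.* (F ⟪ [ α ] ⟫) m)
             ≡⟨ ∑-map (a ∷_) βs (λ α → c α ℚ.* (F ⟪ [ α ] ⟫) m) ⟩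
           ∑ βs (λ β → c (a ∷ β) ℚ.* (F ⟪ [ a ∷ β ] ⟫) m)
             ≡⟨ ∑-cong βs (λ {β} β∈ → trans (cong₂ ℚ._*_ (c-nonempty β (nonempty {n} β∈)) (F-∷ a β m))
                                            (term β)) ⟩
           ∑ βs (λ β → ∑ fs (λ (x , y) → ℚ.- 1ℚ ℚ.* (F a x ℚ.* (c β ℚ.* (F ⟪ [ β ] ⟫) y))))
             ≡⟨ ∑-swap βs fs ⟩
           ∑ fs (λ (x , y) → ∑ βs (λ β → ℚ.- 1ℚ ℚ.* (F a x ℚ.* (c β ℚ.* (F ⟪ [ β ] ⟫) y))))
             ≡⟨ ∑-cong fs (λ {(x , y)} _ → sym (trans (cong (ℚ.- 1ℚ ℚ.*_) (*-∑ (F a x) βs)) (*-∑ (ℚ.- 1ℚ) βs))) ⟩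
           ∑ fs (λ (x , y) → ℚ.- 1ℚ ℚ.* (F a x ℚ.* compositionSum 1 n y))
             ≡⟨ *-∑ (ℚ.- 1ℚ) fs ⟨
           ℚ.- 1ℚ ℚ.* convolve factorisations (F a) (compositionSum 1 n) m
             ≡⟨ solve 1 (λ x → con (ℚ.- 1ℚ) :* x := :- x) refl
                  (convolve factorisations (F a) (compositionSum 1 n) m) ⟩
           ℚ.- convolve factorisations (F a) (compositionSum 1 n) m ∎) ⟩
    ℚ.- convolve factorisations (F a) (compositionSum 1 n) m ℚ.+ compositionSum (suc a) n m ∎
    where
    βs = compositionsFrom 1 n
    fs = factorisations m
    c-nonempty : ∀ β → ¬ β ≡ [] → c (a ∷ β) ≡ ℚ.- c β
    c-nonempty []      β≢[] = contradiction refl β≢[]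
    c-nonempty (b ∷ β) _    = c-∷ a b β
    term : ∀ β → ℚ.- c β ℚ.* convolve factorisations (F a) (F ⟪ [ β ] ⟫) m ≡
                 ∑ fs (λ (x , y) → ℚ.- 1ℚ ℚ.* (F a x ℚ.* (c β ℚ.* (F ⟪ [ β ] ⟫) y)))
    term β = trans (*-∑ (ℚ.- c β) fs) (∑-cong fs (λ {(x , y)} _ →
      solve 3 (λ c x y → :- c :* (x :* y) := con (ℚ.- 1ℚ) :* (x :* (c :* y))) refl
        (c β) (F a x) ((F ⟪ [ β ] ⟫) y)))

  -- Passing from (a, n + 1) to (a + 1, n), the first summand gains F_a P_{n+1} and the second loses
  -- it. That the gain involves P_{n+1} is `compositionSum≡P` at `n`, hence the mutual induction, in
  -- which the second argument drops.
  compositionSum+tail : ∀ a n m →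
    compositionSum a n m ℚ.+ tail a n m ≡ s ℚ.* fromℕ (a + n) ℚ.* F (a + n) m
  compositionSum≡P : ∀ n m → compositionSum 1 n m ≡ P (suc n) m

  compositionSum+tail a zero m = begin
    c [ a ] ℚ.* (F ⟪ [ [ a ] ] ⟫) m ℚ.+ 0ℚ ℚ.+ 0ℚ
      ≡⟨ trans (ℚ.+-identityʳ (c [ a ] ℚ.* (F ⟪ [ [ a ] ] ⟫) m ℚ.+ 0ℚ))
               (ℚ.+-identityʳ (c [ a ] ℚ.* (F ⟪ [ [ a ] ] ⟫) m)) ⟩
    c [ a ] ℚ.* (F ⟪ [ [ a ] ] ⟫) m
      ≡⟨ cong₂ ℚ._*_ (c-[] a) (trans (F-∷ a [] m) (F-*-1 a m)) ⟩
    s ℚ.* fromℕ a ℚ.* F a m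
      ≡⟨ cong (λ k → s ℚ.* fromℕ k ℚ.* F k m) (ℕ.+-identityʳ a) ⟨
    s ℚ.* fromℕ (a + 0) ℚ.* F (a + 0) m ∎
  compositionSum+tail a (suc n) m = begin
    compositionSum a (suc n) m ℚ.+ (f*p ℚ.+ tail (suc a) n m)
      ≡⟨ cong (ℚ._+ (f*p ℚ.+ tail (suc a) n m)) (trans (compositionSum-suc a n m)
           (cong (λ r → ℚ.- r ℚ.+ compositionSum (suc a) n m)
             (∑-cong (factorisations m) (λ {(x , y)} _ → cong (F a x ℚ.*_) (compositionSum≡P n y))))) ⟩
    ℚ.- f*p ℚ.+ compositionSum (suc a) n m ℚ.+ (f*p ℚ.+ tail (suc a) n m)
      ≡⟨ solve 3 (λ p r t → :- p :+ r :+ (p :+ t) := r :+ t) refl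
           f*p (compositionSum (suc a) n m) (tail (suc a) n m) ⟩
    compositionSum (suc a) n m ℚ.+ tail (suc a) n m
      ≡⟨ compositionSum+tail (suc a) n m ⟩
    s ℚ.* fromℕ (suc a + n) ℚ.* F (suc a + n) m
      ≡⟨ cong (λ k → s ℚ.* fromℕ k ℚ.* F k m) (ℕ.+-suc a n) ⟨
    s ℚ.* fromℕ (a + suc n) ℚ.* F (a + suc n) m ∎
    where f*p = convolve factorisations (F a) (P (suc n)) m

  -- The interpolation at a = 1 and Newton's identity have the same right-hand side; what the latter
  -- has beyond `tail 1 n` is the term F_0 P_{n+1}, which is P_{n+1}.
  compositionSum≡P n m = +-G.∙-cancelʳ (tail 1 n m) (compositionSum 1 n m) (P (suc n) m) (begin
    compositionSum 1 n m ℚ.+ tail 1 n m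
      ≡⟨ compositionSum+tail 1 n m ⟩
    s ℚ.* fromℕ (suc n) ℚ.* F (suc n) m
      ≡⟨ tail-0 (suc n) m ⟨
    convolve factorisations (F 0) (P (suc n)) m ℚ.+ tail 1 n m
      ≡⟨ cong (ℚ._+ tail 1 n m) (F0-*-P n m) ⟩
    P (suc n) m ℚ.+ tail 1 n m ∎)

-- The cases F = H and F = E

H-isPos : ∀ x → convolve splitExponent (λ _ → 1ℚ) isPos x ≡ 1ℚ ℚ.* fromℕ x ℚ.* 1ℚ
H-isPos zero    = refl
H-isPos (suc x) = begin
  convolve splitExponent (λ _ → 1ℚ) isPos (suc x)
    ≡⟨ convolve-suc (λ _ → 1ℚ) isPos x ⟩
  1ℚ ℚ.+ convolve splitExponent (λ _ → 1ℚ) isPos x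
    ≡⟨ cong (1ℚ ℚ.+_) (H-isPos x) ⟩
  1ℚ ℚ.+ 1ℚ ℚ.* fromℕ x ℚ.* 1ℚ
    ≡⟨ solve 1 (λ x → con 1ℚ :+ con 1ℚ :* x :* con 1ℚ := con 1ℚ :* (con 1ℚ :+ x) :* con 1ℚ) refl
         (fromℕ x) ⟩
  1ℚ ℚ.* (1ℚ ℚ.+ fromℕ x) ℚ.* 1ℚ
    ≡⟨ cong (λ y → 1ℚ ℚ.* y ℚ.* 1ℚ) (fromℕ-+ 1 x) ⟨
  1ℚ ℚ.* fromℕ (suc x) ℚ.* 1ℚ ∎

H≡ : ∀ d m → H d m ≡ 𝟙[ deg m ℕ.≟ d ] ℚ.* Π (Π (λ _ → 1ℚ)) m
H≡ d m = sym (trans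
  (cong (𝟙[ deg m ℕ.≟ d ] ℚ.*_)
    (Π-one (All.universal (λ row → Π-one (All.universal (λ _ → refl) row)) m)))
  (ℚ.*-identityʳ 𝟙[ deg m ℕ.≟ d ]))

-- Every positive exponent gives -1, because `numVars` counts indeterminates without regard to their
-- exponents.
sgn : ℕ → ℚ
sgn zero    = 1ℚ
sgn (suc _) = ℚ.- 1ℚ

-- The values are 1, -1, 0, 0, .... Over a monomial the two factors multiply to the square-free
-- indicator and to the sign.
hᴱ : ℕ → ℚ
hᴱ x = 𝟙[ x ℕ.≤? 1 ] ℚ.* sgn x

E-isPos : ∀ x → convolve splitExponent hᴱ isPos x ≡ ℚ.- 1ℚ ℚ.* fromℕ x ℚ.* hᴱ x
E-isPos zero          = refl
E-isPos (suc zero)    = refl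
-- From exponent 2 on the partial sums of `hᴱ` are 1 - 1 = 0, and `hᴱ` itself is 0.
E-isPos (suc (suc x)) = begin
  convolve splitExponent hᴱ isPos (2 + x)
    ≡⟨ trans (convolve-suc hᴱ isPos (suc x)) (cong (1ℚ ℚ.+_) (convolve-suc (hᴱ ∘ suc) isPos x)) ⟩
  1ℚ ℚ.+ (ℚ.- 1ℚ ℚ.+ convolve splitExponent (λ _ → 0ℚ) isPos x)
    ≡⟨ cong (λ r → 1ℚ ℚ.+ (ℚ.- 1ℚ ℚ.+ r)) (convolve-0ˡ isPos x) ⟩
  0ℚ
    ≡⟨ ℚ.*-zeroʳ (ℚ.- 1ℚ ℚ.* fromℕ (2 + x)) ⟨
  ℚ.- 1ℚ ℚ.* fromℕ (2 + x) ℚ.* 0ℚ ∎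

Π-* : ∀ (xs : List A) {h k : A → ℚ} → Π (λ x → h x ℚ.* k x) xs ≡ Π h xs ℚ.* Π k xs
Π-* []               = refl
Π-* (x ∷ xs) {h} {k} = trans (cong (h x ℚ.* k x ℚ.*_) (Π-* xs)) (*-interchange (h x) (k x) (Π h xs) (Π k xs))

fromℤ-^ : ∀ i m n → fromℤ (i ℤ.^ (m + n)) ≡ fromℤ (i ℤ.^ m) ℚ.* fromℤ (i ℤ.^ n)
fromℤ-^ i m n = trans (cong fromℤ (ℤ.^-distribˡ-+-* i m n)) (fromℤ-* (i ℤ.^ m) (i ℤ.^ n))

Π-sgn : ∀ row → Π sgn row ≡ fromℤ (ℤ.-1ℤ ℤ.^ length (filter (0 ℕ.<?_) row))
Π-sgn []            = refl
Π-sgn (zero ∷ row)  = trans (ℚ.*-identityˡ (Π sgn row)) (Π-sgn row)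
Π-sgn (suc x ∷ row) = trans (cong (ℚ.- 1ℚ ℚ.*_) (Π-sgn row))
  (sym (fromℤ-^ ℤ.-1ℤ 1 (length (filter (0 ℕ.<?_) row))))

Π-Π-sgn : ∀ m → Π (Π sgn) m ≡ fromℤ (ℤ.-1ℤ ℤ.^ numVars m)
Π-Π-sgn []        = refl
Π-Π-sgn (row ∷ m) = begin
  Π sgn row ℚ.* Π (Π sgn) m
    ≡⟨ cong₂ ℚ._*_ (Π-sgn row) (Π-Π-sgn m) ⟩
  fromℤ (ℤ.-1ℤ ℤ.^ length (filter (0 ℕ.<?_) row)) ℚ.* fromℤ (ℤ.-1ℤ ℤ.^ numVars m)
    ≡⟨ fromℤ-^ ℤ.-1ℤ (length (filter (0 ℕ.<?_) row)) (numVars m) ⟨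
  fromℤ (ℤ.-1ℤ ℤ.^ (length (filter (0 ℕ.<?_) row) + numVars m))
    ≡⟨ cong (λ k → fromℤ (ℤ.-1ℤ ℤ.^ k)) (trans (cong length (filter-++ (0 ℕ.<?_) row (concat m)))
         (length-++ (filter (0 ℕ.<?_) row))) ⟨
  fromℤ (ℤ.-1ℤ ℤ.^ numVars (row ∷ m)) ∎

E≡ : ∀ d m → E d m ≡ 𝟙[ deg m ℕ.≟ d ] ℚ.* Π (Π hᴱ) m
E≡ d m = begin
  𝟙[ squareFree? m ×-dec deg m ℕ.≟ d ] ℚ.* fromℤ (ℤ.-1ℤ ℤ.^ numVars m)
    ≡⟨ cong₂ ℚ._*_ (𝟙-× (squareFree? m) (deg m ℕ.≟ d)) (sym (Π-Π-sgn m)) ⟩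
  𝟙[ squareFree? m ] ℚ.* 𝟙[ deg m ℕ.≟ d ] ℚ.* Π (Π sgn) m
    ≡⟨ solve 3 (λ a b c → a :* b :* c := b :* (a :* c)) refl
         𝟙[ squareFree? m ] 𝟙[ deg m ℕ.≟ d ] (Π (Π sgn) m) ⟩
  𝟙[ deg m ℕ.≟ d ] ℚ.* (𝟙[ squareFree? m ] ℚ.* Π (Π sgn) m)
    ≡⟨ cong (λ i → 𝟙[ deg m ℕ.≟ d ] ℚ.* (i ℚ.* Π (Π sgn) m))
         (trans (Π-cong m (Π-𝟙 (ℕ._≤? 1))) (Π-𝟙 (all? (ℕ._≤? 1)) m)) ⟨
  𝟙[ deg m ℕ.≟ d ] ℚ.* (Π (Π (λ x → 𝟙[ x ℕ.≤? 1 ])) m ℚ.* Π (Π sgn) m)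
    ≡⟨ cong (𝟙[ deg m ℕ.≟ d ] ℚ.*_) (trans (Π-cong m (λ row → Π-* row)) (Π-* m)) ⟨
  𝟙[ deg m ℕ.≟ d ] ℚ.* Π (Π hᴱ) m ∎

signed-[] : ∀ i a → fromℤ (i ℤ.* ℤ.+ L [ [ a ] ]) ≡ fromℤ i ℚ.* fromℕ a
signed-[] i a = trans (fromℤ-* i (ℤ.+ L [ [ a ] ])) (cong (λ k → fromℤ i ℚ.* fromℕ k) (ℕ.+-identityʳ a))

-- `L` reads only the last block, so both occurrences of `L` reduce to the same value and only the
-- sign changes.
signed-∷ : ∀ i a b β → fromℤ (ℤ.-1ℤ ℤ.* i ℤ.* ℤ.+ L [ a ∷ b ∷ β ]) ≡ ℚ.- fromℤ (i ℤ.* ℤ.+ L [ b ∷ β ])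
signed-∷ i a b β = begin
  fromℤ (ℤ.-1ℤ ℤ.* i ℤ.* l)            ≡⟨ cong fromℤ (ℤ.*-assoc ℤ.-1ℤ i l) ⟩
  fromℤ (ℤ.-1ℤ ℤ.* (i ℤ.* l))          ≡⟨ fromℤ-* ℤ.-1ℤ (i ℤ.* l) ⟩
  ℚ.- 1ℚ ℚ.* fromℤ (i ℤ.* l)           ≡⟨ solve 1 (λ x → con (ℚ.- 1ℚ) :* x := :- x) refl (fromℤ (i ℤ.* l)) ⟩
  ℚ.- fromℤ (i ℤ.* l) ∎
  where l = ℤ.+ L [ b ∷ β ]

∑-PComSqf : ∀ n (c : Polycomposition → ℤ.ℤ) (F : ℕ → Series) m →
  ∑ˢ (PComSqf (suc n)) (λ δ → c δ • F ⟪ δ ⟫) m ≡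
  ∑ (compositionsFrom 1 n) (λ α → fromℤ (c [ α ]) ℚ.* (F ⟪ [ α ] ⟫) m)
∑-PComSqf n c F m = trans (∑ℚ≡∑ (PComSqf (suc n)) _)
  (∑-map [_] (compositionsFrom 1 n) (λ δ → fromℤ (c δ) ℚ.* (F ⟪ δ ⟫) m))

open import Data.Integer.Base using (+_; -1ℤ; _*_; _^_)

proposition14 : (d : ℕ) → 1 ≤ d →
    (P d ≈ˢ (∑[ δ ∈ PComSqf d ] ((-1ℤ ^ (ℓ δ ∸ 1) * + L δ) • H ⟪ δ ⟫)))
    × (P d ≈ˢ (∑[ δ ∈ PComSqf d ] ((-1ℤ ^ ℓ δ * + L δ) • E ⟪ δ ⟫)))
proposition14 (suc n) _ = H-identity , E-identity
  where
  cH cE : Polycomposition → ℤ.ℤ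
  cH δ = -1ℤ ^ (ℓ δ ∸ 1) * + L δ
  cE δ = -1ℤ ^ ℓ δ * + L δ
  H-identity : P (suc n) ≈ˢ ∑ˢ (PComSqf (suc n)) (λ δ → cH δ • H ⟪ δ ⟫)
  H-identity m = sym (trans (∑-PComSqf n cH H m)
    -- `ℓ [ b ∷ β ]` is a successor, so the truncated subtraction in the exponent is exact, and one
    -- more part gives one more factor -1.
    (compositionSum≡P H (λ _ → 1ℚ) 1ℚ (fromℤ ∘ cH ∘ [_]) refl H-isPos H≡
      (signed-[] ℤ.1ℤ) (λ a b β → signed-∷ (-1ℤ ^ (ℓ [ b ∷ β ] ∸ 1)) a b β) n m))
  E-identity : P (suc n) ≈ˢ ∑ˢ (PComSqf (suc n)) (λ δ → cE δ • E ⟪ δ ⟫)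
  E-identity m = sym (trans (∑-PComSqf n cE E m)
    (compositionSum≡P E hᴱ (ℚ.- 1ℚ) (fromℤ ∘ cE ∘ [_]) refl E-isPos E≡
      (signed-[] ℤ.-1ℤ) (λ a b β → signed-∷ (-1ℤ ^ ℓ [ b ∷ β ]) a b β) n m))
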